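{- Let $s$ be a weak composition. The $f$-polynomial $\sum_{F\in\operatorname{Asso}(s)}t^{\dim(F)}$ of the $s$-associahedron $\operatorname{Asso}(s)$ is given by $$\sum_T(1+t)^{\operatorname{tasc}(T)},$$ where the sum ranges over all $s$-Tamari trees $T$ and $\operatorname{tasc}(T)$ denotes the number of Tamari-ascents of $T$.
   Context: A weak composition of length $n$ is a sequence $s=(s(1),\dots,s(n))$ of non-negative integers. An $s$-decreasing tree is a rooted planar tree with $n$ internal nodes labeled bijectively by $1,\dots,n$ (leaves are unlabeled) such that node $i$ has exactly $s(i)+1$ ordered children and labels decrease from root to leaves; $T^y_0,\dots,T^y_{s(y)}$ denote the child subtrees of $y$ from left to right. For nodes $a<c$, $\#_T(c,a)$ is $0$ if $a$ is left of $c$ or in $T^c_0$; $i$ if $a$ is in $T^c_i$ with $0<i<s(c)$; $s(c)$ if $a$ is in $T^c_{s(c)}$ or right of $c$. $\operatorname{inv}(T)$ is the multi-set in which $(c,a)$ occurs $\#_T(c,a)$ times; it determines $T$. The $s$-weak order is: $R\preccurlyeq T$ iff $\#_R(c,a)\le\#_T(c,a)$ for all $a<c$. An $s$-Tamari tree is an $s$-decreasing tree with $\#_T(c,a)\le\#_T(c,b)$ for all $a<b<c$. The $s$-Tamari lattice is the restriction of the $s$-weak order to $s$-Tamari trees. A Tamari-ascent of an $s$-Tamari tree $T$ is a pair $(a,c)$, $a<c$, such that $a$ is a non-right child of $c$, i.e. $a$ is the root of $T^c_i$ with $i<s(c)$. The transitive closure $I^{\mathsf{tc}}$ of a multi-set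 $I$ of pairs $(c,a)$, $a<c$, has $\#_{I^{\mathsf{tc}}}(c,a)$ equal to the maximum of $\#_I(b_1,b_2)$ over all lists $c=b_1>\dots>b_k=a$, $k\ge2$, with all $\#_I(b_i,b_{i+1})>0$ ($0$ if none). For a (possibly empty) set $A$ of Tamari-ascents of $T$, $T+A$ is the $s$-Tamari tree whose tree-inversion multi-set is obtained from $\operatorname{inv}(T)$ by increasing $\#_T(c,a)$ by one for each $(a,c)\in A$ and then taking the transitive closure. A pure $s$-Tamari interval is an interval of the $s$-Tamari lattice of the form $[T,T+A]$. The $s$-associahedron $\operatorname{Asso}(s)$ is the collection of all pure $s$-Tamari intervals (its faces); the dimension of $[T,T+A]$ is $|A|$. -}

module Defs where

open import Data.Bool.Base using (if_then_else_)
open import Data.Fin.Base as Fin using (Fin)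
open import Data.Fin.Properties as Fin using (_≟_)
open import Data.List.Base using (List; []; _∷_; _++_; allFin; foldr; length; map)
open import Data.List.Membership.DecPropositional using (_∈?_)
open import Data.List.Relation.Binary.Permutation.Propositional using (_↭_)
open import Data.List.Relation.Binary.Sublist.Propositional using (_⊆_)
open import Data.List.Relation.Unary.All using (All)
import Data.List.Relation.Unary.Enumerates.Setoid as Enumerates
import Data.List.Relation.Unary.Unique.Setoid as Unique
open import Data.Nat.Base using (ℕ; zero; suc; _+_; _*_; _≤_; _<_)
open import Data.Product.Base using (_×_; _,_; ∃-syntax)
open import Data.Product.Properties using (≡-dec)
open import Data.Product.Relation.Binary.Pointwise.NonDependent using (×-setoid)
open import Data.Sum.Base using (_⊎_)
open import Data.Vec.Base using (Vec; []; _∷_; init)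
import Data.Vec.Relation.Unary.All as Vec
open import Level using (0ℓ)
open import Relation.Binary.Bundles using (Setoid)
open import Relation.Binary.Construct.Closure.ReflexiveTransitive using (Star)
import Relation.Binary.Construct.On as On
open import Relation.Binary.PropositionalEquality using (_≡_; setoid)
open import Relation.Nullary.Decidable using (does; yes; no)

-- The labels 1, …, n are represented by Fin n, with its usual order.

WeakComposition : ℕ → Set
WeakComposition n = Fin n → ℕ

------------------------------------------------------------------------
-- s-decreasing trees

data Tree {n : ℕ} (s : WeakComposition n) : Set where
  leaf : Tree s
  node : (i : Fin n) → Vec (Tree s) (suc (s i)) → Tree s

module _ {n : ℕ} {s : WeakComposition n} where

  labels  : Tree s → List (Fin n)
  labelsᶠ : ∀ {k} → Vec (Tree s) k → List (Fin n)

  labels leaf        = []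
  labels (node i ts) = i ∷ labelsᶠ ts

  labelsᶠ []       = []
  labelsᶠ (t ∷ ts) = labels t ++ labelsᶠ ts

  data Decreasing : Tree s → Set where
    leaf : Decreasing leaf
    node : ∀ {i ts} →
           Vec.All (λ t → All (Fin._< i) (labels t) × Decreasing t) ts →
           Decreasing (node i ts)

  record IsSDecreasing (T : Tree s) : Set where
    field
      bijective  : labels T ↭ allFin n
      decreasing : Decreasing T

------------------------------------------------------------------------
-- Multi-sets of pairs (c , a) with a < c, given by their multiplicities:
-- I c a is the multiplicity of (c , a).  Values with a ≥ c are junk.

MultiSet : ℕ → Set
MultiSet n = Fin n → Fin n → ℕ

module _ {n : ℕ} {s : WeakComposition n} where

  -- The index of the first tree containing the label a.
  position : ∀ {k} → Fin n → Vec (Tree s) k → ℕ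
  position a []       = 0
  position a (t ∷ ts) =
    if does (_∈?_ _≟_ a (labels t)) then 0 else suc (position a ts)

  -- inv T c a is #_T(c,a).  The search descends to the smallest subtree
  -- containing both a and c.  If its root is c, then a lies in some T^c_i
  -- and the value is i.  Otherwise (its root not being a, as a < c) a and c
  -- lie in different child subtrees, so a is left or right of c.
  inv  : Tree s → MultiSet n
  invᶠ : ∀ {k} → Vec (Tree s) k → MultiSet n

  inv leaf        c a = 0
  inv (node x ts) c a with x ≟ c
  ... | yes _ = position a ts
  ... | no  _ = invᶠ ts c a

  invᶠ []       c a = 0
  invᶠ (t ∷ ts) c a with _∈?_ _≟_ a (labels t) | _∈?_ _≟_ c (labels t)
  ... | yes _ | yes _ = inv t c a
  ... | yes _ | no  _ = 0
  ... | no  _ | yes _ = s c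
  ... | no  _ | no  _ = invᶠ ts c a

module _ {n : ℕ} (I : MultiSet n) where

  Step : Fin n → Fin n → Set
  Step c b = b Fin.< c × 0 < I c b

  -- J is the transitive closure of I: J c a is the maximum of the first
  -- multiplicity I b₁ b₂ over all lists c = b₁ > b₂ > … > b_k = a, k ≥ 2,
  -- of steps of positive multiplicity, and 0 if there is no such list.
  -- (If there is one, the bound makes J c a positive, so it is attained.)
  record IsTransitiveClosure (J : MultiSet n) : Set where
    field
      bound    : ∀ {c a} → a Fin.< c →
                 ∀ b → Step c b → Star Step b a → I c b ≤ J c a
      attained : ∀ {c a} → a Fin.< c →
                 J c a ≡ 0 ⊎ (∃[ b ] Step c b × Star Step b a × J c a ≡ I c b)

------------------------------------------------------------------------
-- The s-Tamari lattice

record TamariTree {n : ℕ} (s : WeakComposition n) : Set where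
  field
    tree          : Tree s
    isSDecreasing : IsSDecreasing tree
    isTamari      : ∀ {a b c} → a Fin.< b → b Fin.< c →
                    inv tree c a ≤ inv tree c b

open TamariTree using (tree)

TamariTrees : ∀ {n} → WeakComposition n → Setoid 0ℓ 0ℓ
TamariTrees s = On.setoid (setoid (Tree s)) (tree {s = s})

module _ {n : ℕ} {s : WeakComposition n} where

  infix 4 _≼_

  _≼_ : TamariTree s → TamariTree s → Set
  R ≼ T = ∀ {a c} → a Fin.< c → inv (tree R) c a ≤ inv (tree T) c a

  -- rootPairs c ts pairs the roots of the non-leaf trees in ts with c.
  rootPairs : ∀ {k} → Fin n → Vec (Tree s) k → List (Fin n × Fin n)
  rootPairs c []               = []
  rootPairs c (leaf     ∷ ts)  = rootPairs c ts
  rootPairs c (node a _ ∷ ts)  = (a , c) ∷ rootPairs c ts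

  -- The list of all (a , c) such that a is a non-right child of c.  When the
  -- tree is s-decreasing, a < c holds and the list has no repetitions.
  ascents  : Tree s → List (Fin n × Fin n)
  ascentsᶠ : ∀ {k} → Vec (Tree s) k → List (Fin n × Fin n)

  ascents leaf        = []
  ascents (node c ts) = rootPairs c (init ts) ++ ascentsᶠ ts

  ascentsᶠ []       = []
  ascentsᶠ (t ∷ ts) = ascents t ++ ascentsᶠ ts

  tamariAscents : TamariTree s → List (Fin n × Fin n)
  tamariAscents T = ascents (tree T)

  tasc : TamariTree s → ℕ
  tasc T = length (tamariAscents T)

------------------------------------------------------------------------
-- The s-associahedron

increase : ∀ {n} → List (Fin n × Fin n) → MultiSet n → MultiSet n
increase A I c a =
  if does (_∈?_ (≡-dec _≟_ _≟_) (a , c) A) then suc (I c a) else I c a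

record Interval {n : ℕ} (s : WeakComposition n) : Set where
  field
    bottom top : TamariTree s
    bottom≼top : bottom ≼ top

module _ {n : ℕ} {s : WeakComposition n} where

  -- IsSum T A S says that S is T + A.  Since inv determines a tree, there is
  -- at most one such S.
  IsSum : TamariTree s → List (Fin n × Fin n) → TamariTree s → Set
  IsSum T A S =
    IsTransitiveClosure (increase A (inv (tree T))) (inv (tree S))

-- Sets of Tamari-ascents are represented by sublists of the repetition-free
-- list of all of them.
record Face {n : ℕ} (s : WeakComposition n) : Set where
  field
    interval : Interval s
  open Interval interval public
  field
    A         : List (Fin n × Fin n)
    A⊆ascents : A ⊆ tamariAscents bottom
    top≡T+A   : IsSum bottom A top

  dim : ℕ
  dim = length A

open Face using (dim)

-- Faces are intervals: two faces are equal as soon as their endpoints are,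
-- whatever the sets A presenting them.
Asso : ∀ {n} → WeakComposition n → Setoid 0ℓ 0ℓ
Asso s = On.setoid (×-setoid (TamariTrees s) (TamariTrees s))
                   (λ (F : Face s) → Face.bottom F , Face.top F)

------------------------------------------------------------------------
-- Polynomials in t over ℕ, as lists of coefficients starting with the
-- constant one.  Trailing zeros are allowed, so equality is _≈ₚ_.

Poly : Set
Poly = List ℕ

coeff : Poly → ℕ → ℕ
coeff []      k       = 0
coeff (x ∷ p) zero    = x
coeff (x ∷ p) (suc k) = coeff p k

infix  4 _≈ₚ_
infixl 6 _+ₚ_
infixl 7 _*ₚ_
infixr 8 _^ₚ_

_≈ₚ_ : Poly → Poly → Set
p ≈ₚ q = ∀ k → coeff p k ≡ coeff q k

0ₚ 1ₚ t : Poly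
0ₚ = []
1ₚ = 1 ∷ []
t  = 0 ∷ 1 ∷ []

_+ₚ_ : Poly → Poly → Poly
[]      +ₚ q       = q
(x ∷ p) +ₚ []      = x ∷ p
(x ∷ p) +ₚ (y ∷ q) = x + y ∷ p +ₚ q

_*ₚ_ : Poly → Poly → Poly
[]      *ₚ q = []
(x ∷ p) *ₚ q = map (x *_) q +ₚ (0 ∷ p *ₚ q)

_^ₚ_ : Poly → ℕ → Poly
p ^ₚ zero  = 1ₚ
p ^ₚ suc k = p *ₚ (p ^ₚ k)

------------------------------------------------------------------------
-- Finite sums

-- A list containing every element exactly once, up to the setoid equality.
record Enumeration (S : Setoid 0ℓ 0ℓ) : Set where
  field
    elements   : List (Setoid.Carrier S)
    enumerates : Enumerates.IsEnumeration S elements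
    unique     : Unique.Unique S elements

∑ : ∀ {S} → Enumeration S → (Setoid.Carrier S → Poly) → Poly
∑ E f = foldr (λ x p → f x +ₚ p) 0ₚ (Enumeration.elements E)

infix 5 ∑
syntax ∑ E (λ x → p) = ∑[ x ∈ E ] p

fPolynomial : ∀ {n} {s : WeakComposition n} → Enumeration (Asso s) → Poly
fPolynomial ℱ = ∑[ F ∈ ℱ ] t ^ₚ dim F

{-# OPTIONS --safe #-}
module Submission where

-- Each face is an interval [T, T + A] with A a set of Tamari-ascents of T. If T + A exists for
-- every such A, and if A can be recovered from T and T + A, then the faces with bottom T
-- correspond to the subsets of the tasc(T) ascents of T and contribute Σ t^|A| = (1 + t)^tasc(T).
-- Summing over T gives the claim; that any two enumerations of a setoid give the same sum
-- (sum-unique) makes the choice of enumerations irrelevant.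
--
-- Both properties of T + A come from a description of the inversions of s-Tamari trees. In an
-- s-Tamari tree the labels of every subtree form an interval, and consecutive child subtrees carry
-- consecutive intervals (intervalTree; conversely toTamari). Reading inversions off such interval
-- trees shows that I = inv T satisfies, for a < b < c,
--   I c a ≤ s c,   I c a ≤ I c b,   and   I c b ≤ I c a whenever I b a > 0
-- (inv-bound, inv-mono, inv-trans). Conversely every multi-set with these three properties is the
-- inversion multi-set of exactly one s-Tamari tree (realise, tree-injective). An ascent (a , c)
-- satisfies moreover I c a < s c, I c a < I c b for a < b < c, and I d c = I d a for d > c
-- (ascent).
--
-- Existence of T + A (plus): by the two strict inequalities for ascents, raising I by one on A
-- preserves the first two properties; and the transitive closure of a multi-set with the first two
-- properties has all three (closure-isTamariInversions).
--
-- Recovery of A (plus-injective): if (a , c) lies in A then (c , a) has larger multiplicity in T +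
-- A than in T. If (a , c) is an ascent outside A, the multiplicity is unchanged: a chain from c to
-- a whose first step goes to some d > a starts with I c d > I c a, but I c does not decrease along
-- the steps of the chain (by the third property, or by I c e = I c d for an ascent (d , e) in A),
-- so it can never come down to I c a.

open import Defs
open import Data.Nat.Base using (ℕ)
open import Data.Product.Base using (_×_)

open import Data.Bool.Base using (if_then_else_)
open import Data.Fin.Base as Fin using (Fin; zero; suc; toℕ; fromℕ<)
open import Data.Fin.Induction using (<-wellFounded)
open import Data.Fin.Properties as Fin using (_≟_; toℕ-injective; toℕ<n; toℕ-fromℕ<)
open import Data.List.Base
  using (List; []; _∷_; _++_; allFin; cartesianProductWith; concatMap; deduplicate; foldr;
         length; map; mapMaybe)
open import Data.List.Membership.DecPropositional using (_∈?_)
open import Data.List.Membership.Propositional using (_∈_; _∉_; lose)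
open import Data.List.Membership.Propositional.Properties
  using (∈-++⁺ˡ; ∈-++⁺ʳ; ∈-++⁻; ∈-allFin; ∈-cartesianProductWith⁺; ∈-concatMap⁺; ∈-map⁺)
open import Data.List.Membership.Propositional.Properties.WithK using (unique∧set⇒bag)
import Data.List.Membership.Setoid as Membershipₛ
open import Data.List.Membership.Setoid.Properties using (∈-deduplicate⁺)
open import Data.List.Properties using (map-++; map-∘; map-cong)
open import Data.List.Relation.Binary.BagAndSetEquality using (∼bag⇒↭)
open import Data.List.Relation.Binary.Disjoint.Propositional using (Disjoint)
open import Data.List.Relation.Binary.Permutation.Propositional using (↭-sym; ↭⇒↭ₛ)
open import Data.List.Relation.Binary.Permutation.Propositional.Properties using (∈-resp-↭)
import Data.List.Relation.Binary.Permutation.Setoid.Properties as ↭ₛ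
open import Data.List.Relation.Binary.Sublist.Propositional using (_⊆_; []; _∷_; _∷ʳ_; lookup)
open import Data.List.Relation.Unary.All as All using (All; []; _∷_)
import Data.List.Relation.Unary.All.Properties as All
open import Data.List.Relation.Unary.AllPairs as AllPairs using (AllPairs; []; _∷_)
import Data.List.Relation.Unary.AllPairs.Properties as AllPairs
open import Data.List.Relation.Unary.Any as Any using (Any; here; there)
import Data.List.Relation.Unary.Any.Properties as Any
import Data.List.Relation.Unary.Unique.DecSetoid.Properties as DecUnique
open import Data.List.Relation.Unary.Unique.Propositional using (Unique)
import Data.List.Relation.Unary.Unique.Propositional.Properties as Unique
import Data.List.Relation.Unary.Unique.Setoid as Uniqueₛ
open import Data.Maybe.Base using (Maybe; just; nothing)
import Data.Maybe.Relation.Unary.Any as Maybe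
open import Data.Nat.Base
  using (zero; suc; pred; _+_; _*_; _≤_; _<_; z≤n; s≤s; s≤s⁻¹; z<s; s<s; ≢-nonZero)
open import Data.Nat.ListAction using (sum)
open import Data.Nat.ListAction.Properties using (sum-++)
open import Data.Nat.Properties as ℕ
  using (_<?_; ≤-refl; ≤-trans; ≤-reflexive; <-trans; <⇒≤; <-≤-trans; ≮⇒≥; <⇒≱;
         <-irrefl; n<1+n)
open import Data.Product.Base using (_,_; proj₁; proj₂; ∃-syntax)
open import Data.Product.Properties using (≡-dec)
open import Data.Sum.Base using (_⊎_; inj₁; inj₂)
open import Data.Vec.Base using (Vec; []; _∷_; init)
open import Data.Vec.Relation.Unary.All as Vec using ([]; _∷_)
open import Function.Base using (_on_)
open import Function.Bundles using (mk⇔)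
open import Induction.WellFounded using (Acc; acc)
open import Level using (0ℓ)
open import Relation.Binary.Bundles using (Setoid; DecSetoid)
open import Relation.Binary.Construct.Closure.ReflexiveTransitive using (Star; ε; _◅_; _◅◅_)
open import Relation.Binary.Definitions using (DecidableEquality; Decidable)
open import Relation.Binary.PropositionalEquality
  using (_≡_; _≢_; refl; sym; trans; cong; cong₂; subst; subst₂; setoid; module ≡-Reasoning)
open import Relation.Nullary using (¬_; contradiction)
open import Relation.Nullary.Decidable using (Dec; yes; no; does; map′; _×-dec_)

------------------------------------------------------------------------
-- Repetition-free lists

unique-++⁻ : {X : Set} (xs : List X) {ys : List X} → Unique (xs ++ ys) →
             Unique xs × Unique ys × Disjoint xs ys
unique-++⁻ []       unique        = [] , unique , λ ()
unique-++⁻ (x ∷ xs) (x∉ ∷ unique) = let unique₁ , unique₂ , disjoint = unique-++⁻ xs unique in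
  All.++⁻ˡ xs x∉ ∷ unique₁ , unique₂ , λ
    { (here refl , q) → All.lookup (All.++⁻ʳ xs x∉) q refl
    ; (there p   , q) → disjoint (p , q)
    }

-- A sublist of a repetition-free list is determined by its set of elements.
sublist-unique : {X : Set} {A B xs : List X} → Unique xs → A ⊆ xs → B ⊆ xs →
                 (∀ {x} → x ∈ A → x ∈ B) → (∀ {x} → x ∈ B → x ∈ A) → A ≡ B
sublist-unique _ [] [] _ _ = refl
sublist-unique (_ ∷ xs!) (_ ∷ʳ p) (_ ∷ʳ q) A⇒B B⇒A = sublist-unique xs! p q A⇒B B⇒A
sublist-unique (x∉ ∷ _) (refl ∷ p) (_ ∷ʳ q) A⇒B _ =
    contradiction refl (All.lookup x∉ (lookup q (A⇒B (here refl))))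
sublist-unique (x∉ ∷ _) (_ ∷ʳ p) (refl ∷ q) _ B⇒A =
    contradiction refl (All.lookup x∉ (lookup p (B⇒A (here refl))))
sublist-unique {X = X} (x∉ ∷ xs!) (refl ∷ p) (refl ∷ q) A⇒B B⇒A =
  cong (_ ∷_) (sublist-unique xs! p q (drop p A⇒B) (drop q B⇒A))
  where
  drop : ∀ {A B} → A ⊆ _ → (∀ {x} → x ∈ _ ∷ A → x ∈ _ ∷ B) → ∀ {x} → x ∈ A → x ∈ B
  drop p A⇒B x∈A with A⇒B (there x∈A)
  ... | here refl = contradiction refl (All.lookup x∉ (lookup p x∈A))
  ... | there x∈B = x∈B

------------------------------------------------------------------------
-- One step of the recursion defining position and inv

module _ {n : ℕ} {s : WeakComposition n} where

  private variable
    k l m u u′ : ℕ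
    a b c i : Fin n
    t₁ t₂ : Tree s
    ts ts′ : Vec (Tree s) k

  position-∈ : a ∈ labels t₁ → position a (t₁ ∷ ts) ≡ 0
  position-∈ {a} {t₁} p with _∈?_ _≟_ a (labels t₁)
  ... | yes _ = refl
  ... | no ¬p = contradiction p ¬p

  position-∉ : a ∉ labels t₁ → position a (t₁ ∷ ts) ≡ suc (position a ts)
  position-∉ {a} {t₁} ¬p with _∈?_ _≟_ a (labels t₁)
  ... | yes p = contradiction p ¬p
  ... | no _  = refl

  invᶠ-∈∈ : a ∈ labels t₁ → c ∈ labels t₁ → invᶠ (t₁ ∷ ts) c a ≡ inv t₁ c a
  invᶠ-∈∈ {a} {t₁} {c} p q with _∈?_ _≟_ a (labels t₁) | _∈?_ _≟_ c (labels t₁)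
  ... | yes _ | yes _ = refl
  ... | no ¬p | _     = contradiction p ¬p
  ... | yes _ | no ¬q = contradiction q ¬q

  invᶠ-∈∉ : a ∈ labels t₁ → c ∉ labels t₁ → invᶠ (t₁ ∷ ts) c a ≡ 0
  invᶠ-∈∉ {a} {t₁} {c} p ¬q with _∈?_ _≟_ a (labels t₁) | _∈?_ _≟_ c (labels t₁)
  ... | yes _ | yes q = contradiction q ¬q
  ... | no ¬p | _     = contradiction p ¬p
  ... | yes _ | no _  = refl

  invᶠ-∉∉ : a ∉ labels t₁ → c ∉ labels t₁ → invᶠ (t₁ ∷ ts) c a ≡ invᶠ ts c a
  invᶠ-∉∉ {a} {t₁} {c} ¬p ¬q with _∈?_ _≟_ a (labels t₁) | _∈?_ _≟_ c (labels t₁)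
  ... | yes p | _     = contradiction p ¬p
  ... | no _  | yes q = contradiction q ¬q
  ... | no _  | no _  = refl

  inv-root : inv (node i ts) i a ≡ position a ts
  inv-root {i} with i ≟ i
  ... | yes _  = refl
  ... | no i≢i = contradiction refl i≢i

  inv-nonroot : c Fin.< i → inv (node i ts) c a ≡ invᶠ ts c a
  inv-nonroot {c} {i} c<i with i ≟ c
  ... | yes refl = contradiction c<i (<-irrefl refl)
  ... | no _     = refl

  ----------------------------------------------------------------------
  -- Interval trees

  label-at : u < n → ∃[ i ] toℕ i ≡ u
  label-at u<n = fromℕ< u<n , toℕ-fromℕ< u<n

  -- IntervalTree l u t: the labels of t are those in the interval from l (included) to u
  -- (excluded), and for every node the label sets of its child subtrees are consecutive intervals,
  -- from left to right. A node carries the largest label of its interval, whence the upper bound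
  -- suc (toℕ i). IntervalForest l u ts says that the trees ts partition the interval into
  -- consecutive ones.
  data IntervalTree   : ℕ → ℕ → Tree s → Set
  data IntervalForest : ℕ → ℕ → Vec (Tree s) k → Set

  data IntervalTree where
    leaf : IntervalTree l l leaf
    node : IntervalForest l (toℕ i) ts → IntervalTree l (suc (toℕ i)) (node i ts)

  data IntervalForest where
    []  : IntervalForest l l []
    _∷_ : IntervalTree l m t₁ → IntervalForest m u ts → IntervalForest l u (t₁ ∷ ts)

  tree-≤   : IntervalTree l u t₁ → l ≤ u
  forest-≤ : IntervalForest l u ts → l ≤ u
  tree-≤ leaf       = ≤-refl
  tree-≤ (node f)   = ≤-trans (forest-≤ f) (ℕ.n≤1+n _)
  forest-≤ []       = ≤-refl
  forest-≤ (x ∷ f)  = ≤-trans (tree-≤ x) (forest-≤ f)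

  ∈-tree⁻   : IntervalTree l u t₁ → a ∈ labels t₁ → l ≤ toℕ a × toℕ a < u
  ∈-forest⁻ : IntervalForest l u ts → a ∈ labelsᶠ ts → l ≤ toℕ a × toℕ a < u
  ∈-tree⁻ (node f) (here refl) = forest-≤ f , ≤-refl
  ∈-tree⁻ (node f) (there p)   = let l≤a , a<i = ∈-forest⁻ f p in l≤a , <-trans a<i (n<1+n _)
  ∈-forest⁻ {ts = t₁ ∷ _} (x ∷ f) p with ∈-++⁻ (labels t₁) p
  ... | inj₁ p = let l≤a , a<m = ∈-tree⁻ x p in l≤a , <-≤-trans a<m (forest-≤ f)
  ... | inj₂ p = let m≤a , a<u = ∈-forest⁻ f p in ≤-trans (tree-≤ x) m≤a , a<u

  ∈-tree⁺   : IntervalTree l u t₁ → l ≤ toℕ a → toℕ a < u → a ∈ labels t₁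
  ∈-forest⁺ : IntervalForest l u ts → l ≤ toℕ a → toℕ a < u → a ∈ labelsᶠ ts
  ∈-tree⁺ leaf l≤a a<u = contradiction l≤a (<⇒≱ a<u)
  ∈-tree⁺ {a = a} (node {i = i} f) l≤a a≤i with a ≟ i
  ... | yes a≡i = here a≡i
  ... | no  a≢i = there (∈-forest⁺ f l≤a (Fin.≤∧≢⇒< (s≤s⁻¹ a≤i) a≢i))
  ∈-forest⁺ [] l≤a a<u = contradiction l≤a (<⇒≱ a<u)
  ∈-forest⁺ {a = a} (_∷_ {m = m} {t₁ = t₁} x f) l≤a a<u with toℕ a <? m
  ... | yes a<m = ∈-++⁺ˡ (∈-tree⁺ x l≤a a<m)
  ... | no  a≮m = ∈-++⁺ʳ (labels t₁) (∈-forest⁺ f (≮⇒≥ a≮m) a<u)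

  ∉-tree : IntervalTree l m t₁ → m ≤ toℕ a → a ∉ labels t₁
  ∉-tree x m≤a a∈t = <⇒≱ (proj₂ (∈-tree⁻ x a∈t)) m≤a

  position-< : IntervalTree l m t₁ → l ≤ toℕ a → toℕ a < m → position a (t₁ ∷ ts) ≡ 0
  position-< {ts = ts} x l≤a a<m = position-∈ {ts = ts} (∈-tree⁺ x l≤a a<m)

  position-≥ : IntervalTree l m t₁ → m ≤ toℕ a → position a (t₁ ∷ ts) ≡ suc (position a ts)
  position-≥ {ts = ts} x m≤a = position-∉ {ts = ts} (∉-tree x m≤a)

  invᶠ-< : IntervalTree l m t₁ → l ≤ toℕ a → a Fin.< c → toℕ c < m →
           invᶠ (t₁ ∷ ts) c a ≡ inv t₁ c a
  invᶠ-< x l≤a a<c c<m =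
    invᶠ-∈∈ (∈-tree⁺ x l≤a (<-trans a<c c<m)) (∈-tree⁺ x (≤-trans l≤a (<⇒≤ a<c)) c<m)

  invᶠ-≥ : IntervalTree l m t₁ → m ≤ toℕ a → a Fin.< c →
           invᶠ (t₁ ∷ ts) c a ≡ invᶠ ts c a
  invᶠ-≥ x m≤a a<c = invᶠ-∉∉ (∉-tree x m≤a) (∉-tree x (≤-trans m≤a (<⇒≤ a<c)))

  -- In an interval forest a smaller label in another tree is always to the left, so the
  -- multiplicity between different trees is zero.
  invᶠ-across : IntervalTree l m t₁ → l ≤ toℕ a → toℕ a < m → m ≤ toℕ c →
                invᶠ (t₁ ∷ ts) c a ≡ 0
  invᶠ-across x l≤a a<m m≤c = invᶠ-∈∉ (∈-tree⁺ x l≤a a<m) (∉-tree x m≤c)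

  -- In an interval with largest label i, the label c is either i or below i.
  data Last : Fin n → Fin n → Set where
    root  : Last i i
    below : c Fin.< i → Last i c

  last? : toℕ c < suc (toℕ i) → Last i c
  last? {c} {i} c≤i with c ≟ i
  ... | yes refl = root
  ... | no  c≢i  = below (Fin.≤∧≢⇒< (s≤s⁻¹ c≤i) c≢i)

  ----------------------------------------------------------------------
  -- Inversions of interval trees

  position-bound : IntervalForest {k} l u ts → l ≤ toℕ a → toℕ a < u → position a ts < k
  position-bound [] l≤a a<u = contradiction l≤a (<⇒≱ a<u)
  position-bound {a = a} (_∷_ {m = m} {ts = ts} x f) l≤a a<u with toℕ a <? m
  ... | yes a<m rewrite position-< {ts = ts} x l≤a a<m = z<s
  ... | no  a≮m rewrite position-≥ {a = a} {ts = ts} x (≮⇒≥ a≮m) =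
      s<s (position-bound f (≮⇒≥ a≮m) a<u)

  inv-bound  : IntervalTree l u t₁ → l ≤ toℕ a → a Fin.< c → toℕ c < u → inv t₁ c a ≤ s c
  invᶠ-bound : IntervalForest l u ts → l ≤ toℕ a → a Fin.< c → toℕ c < u → invᶠ ts c a ≤ s c
  inv-bound leaf l≤a a<c c<u = z≤n
  inv-bound {a = a} (node {ts = ts} f) l≤a a<c c<u with last? c<u
  ... | root rewrite inv-root {ts = ts} {a = a} = s≤s⁻¹ (position-bound f l≤a a<c)
  ... | below c<i rewrite inv-nonroot {ts = ts} {a = a} c<i = invᶠ-bound f l≤a a<c c<i
  invᶠ-bound [] l≤a a<c c<u = z≤n
  invᶠ-bound {a = a} {c = c} (_∷_ {m = m} {ts = ts} x f) l≤a a<c c<u with toℕ c <? m | toℕ a <? m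
  ... | yes c<m | _ rewrite invᶠ-< {ts = ts} x l≤a a<c c<m = inv-bound x l≤a a<c c<m
  ... | no  c≮m | yes a<m rewrite invᶠ-across {c = c} {ts = ts} x l≤a a<m (≮⇒≥ c≮m) = z≤n
  ... | no  c≮m | no  a≮m rewrite invᶠ-≥ {ts = ts} x (≮⇒≥ a≮m) a<c = invᶠ-bound f (≮⇒≥ a≮m) a<c c<u

  position-mono : IntervalForest l u ts → l ≤ toℕ a → a Fin.< b → toℕ b < u →
                  position a ts ≤ position b ts
  position-mono [] l≤a a<b b<u = z≤n
  position-mono {a = a} (_∷_ {m = m} {ts = ts} x f) l≤a a<b b<u with toℕ a <? m
  ... | yes a<m rewrite position-< {ts = ts} x l≤a a<m = z≤n
  ... | no  a≮m
      rewrite position-≥ {a = a} {ts = ts} x (≮⇒≥ a≮m)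
            | position-≥ {ts = ts} x (≤-trans (≮⇒≥ a≮m) (<⇒≤ a<b))
      = s≤s (position-mono f (≮⇒≥ a≮m) a<b b<u)

  inv-mono  : IntervalTree l u t₁ → l ≤ toℕ a → a Fin.< b → b Fin.< c → toℕ c < u →
              inv t₁ c a ≤ inv t₁ c b
  invᶠ-mono : IntervalForest l u ts → l ≤ toℕ a → a Fin.< b → b Fin.< c → toℕ c < u →
              invᶠ ts c a ≤ invᶠ ts c b
  inv-mono leaf l≤a a<b b<c c<u = z≤n
  inv-mono {a = a} {b = b} (node {ts = ts} f) l≤a a<b b<c c<u with last? c<u
  ... | root rewrite inv-root {ts = ts} {a = a} | inv-root {ts = ts} {a = b} =
      position-mono f l≤a a<b b<c
  ... | below c<i rewrite inv-nonroot {ts = ts} {a = a} c<i | inv-nonroot {ts = ts} {a = b} c<i =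
    invᶠ-mono f l≤a a<b b<c c<i
  invᶠ-mono [] l≤a a<b b<c c<u = z≤n
  invᶠ-mono {a = a} {b = b} {c = c} (_∷_ {m = m} {ts = ts} x f) l≤a a<b b<c c<u 
    with toℕ c <? m | toℕ a <? m
  ... | yes c<m | _
      rewrite invᶠ-< {ts = ts} x l≤a (<-trans a<b b<c) c<m
            | invᶠ-< {ts = ts} x (≤-trans l≤a (<⇒≤ a<b)) b<c c<m = inv-mono x l≤a a<b b<c c<m
  ... | no  c≮m | yes a<m rewrite invᶠ-across {c = c} {ts = ts} x l≤a a<m (≮⇒≥ c≮m) = z≤n
  ... | no  c≮m | no  a≮m
      rewrite invᶠ-≥ {ts = ts} x (≮⇒≥ a≮m) (<-trans a<b b<c)
            | invᶠ-≥ {ts = ts} x (≤-trans (≮⇒≥ a≮m) (<⇒≤ a<b)) b<c =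
                invᶠ-mono f (≮⇒≥ a≮m) a<b b<c c<u

  -- With position-mono, the trees containing a and b are the same as soon as b has a positive
  -- multiplicity over a.
  position-antitone : IntervalForest l u ts → l ≤ toℕ a → a Fin.< b → toℕ b < u →
                      0 < invᶠ ts b a → position b ts ≤ position a ts
  position-antitone [] l≤a a<b b<u ()
  position-antitone {a = a} {b = b} (_∷_ {m = m} {ts = ts} x f) l≤a a<b b<u pos
    with toℕ b <? m | toℕ a <? m
  ... | yes b<m | _ rewrite position-< {ts = ts} x (≤-trans l≤a (<⇒≤ a<b)) b<m = z≤n
  ... | no  b≮m | yes a<m rewrite invᶠ-across {c = b} {ts = ts} x l≤a a<m (≮⇒≥ b≮m) =
      contradiction pos λ ()
  ... | no  b≮m | no  a≮m
      rewrite position-≥ {a = a} {ts = ts} x (≮⇒≥ a≮m) | position-≥ {a = b} {ts = ts} x (≮⇒≥ b≮m)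
            | invᶠ-≥ {ts = ts} x (≮⇒≥ a≮m) a<b = s≤s (position-antitone f (≮⇒≥ a≮m) a<b b<u pos)

  inv-trans  : IntervalTree l u t₁ → l ≤ toℕ a → a Fin.< b → b Fin.< c → toℕ c < u →
               0 < inv t₁ b a → inv t₁ c b ≤ inv t₁ c a
  invᶠ-trans : IntervalForest l u ts → l ≤ toℕ a → a Fin.< b → b Fin.< c → toℕ c < u →
               0 < invᶠ ts b a → invᶠ ts c b ≤ invᶠ ts c a
  inv-trans leaf l≤a a<b b<c c<u ()
  inv-trans {a = a} {b = b} (node {ts = ts} f) l≤a a<b b<c c<u pos with last? c<u
  ... | root
      rewrite inv-root {ts = ts} {a = a} | inv-root {ts = ts} {a = b}
            | inv-nonroot {ts = ts} {a = a} b<c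
      = position-antitone f l≤a a<b b<c pos
  ... | below c<i
      rewrite inv-nonroot {ts = ts} {a = a} c<i | inv-nonroot {ts = ts} {a = b} c<i
            | inv-nonroot {ts = ts} {a = a} (<-trans b<c c<i) = invᶠ-trans f l≤a a<b b<c c<i pos
  invᶠ-trans [] l≤a a<b b<c c<u ()
  invᶠ-trans {a = a} {b = b} {c = c} (_∷_ {m = m} {ts = ts} x f) l≤a a<b b<c c<u pos
    with toℕ c <? m | toℕ b <? m | toℕ a <? m
  ... | yes c<m | _ | _
      rewrite invᶠ-< {ts = ts} x l≤a (<-trans a<b b<c) c<m
            | invᶠ-< {ts = ts} x (≤-trans l≤a (<⇒≤ a<b)) b<c c<m
            | invᶠ-< {ts = ts} x l≤a a<b (<-trans b<c c<m) = inv-trans x l≤a a<b b<c c<m pos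
  ... | no  c≮m | yes b<m | _
      rewrite invᶠ-across {c = c} {ts = ts} x (≤-trans l≤a (<⇒≤ a<b)) b<m (≮⇒≥ c≮m) = z≤n
  ... | no  c≮m | no b≮m | yes a<m
      rewrite invᶠ-across {c = b} {ts = ts} x l≤a a<m (≮⇒≥ b≮m) = contradiction pos λ ()
  ... | no  c≮m | no b≮m | no  a≮m
      rewrite invᶠ-≥ {ts = ts} x (≮⇒≥ a≮m) (<-trans a<b b<c)
            | invᶠ-≥ {ts = ts} x (≮⇒≥ b≮m) b<c
            | invᶠ-≥ {ts = ts} x (≮⇒≥ a≮m) a<b = invᶠ-trans f (≮⇒≥ a≮m) a<b b<c c<u pos

  ----------------------------------------------------------------------
  -- Inversions at ascents

  -- What the inversions I of an interval tree on the labels from l to u satisfy at a Tamari-ascent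
  -- (a , c). By level, labels above c do not distinguish a from c; by jump, those between a and c
  -- have a larger multiplicity than a under c.
  record Ascent (I : MultiSet n) (l u : ℕ) (a c : Fin n) : Set where
    field
      lower    : l ≤ toℕ a
      a<c      : a Fin.< c
      upper    : toℕ c < u
      nonright : I c a < s c
      jump     : ∀ {b} → a Fin.< b → b Fin.< c → I c a < I c b
      level    : ∀ {d} → c Fin.< d → toℕ d < u → I d c ≡ I d a

  -- The corresponding facts in terms of positions, for a root a of a tree other than the last one
  -- in the forest ts of child subtrees of i. The forest has suc k trees, so the last position is k.
  record RootPair (l u : ℕ) (ts : Vec (Tree s) (suc k)) (i a c : Fin n) : Set where
    field
      c≡i      : c ≡ i
      lower    : l ≤ toℕ a
      upper    : toℕ a < u
      nonright : position a ts < k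
      jump     : ∀ {b} → a Fin.< b → toℕ b < u → position a ts < position b ts

  rootPair-∷ : IntervalTree l m t₁ → RootPair m u ts i a c → RootPair l u (t₁ ∷ ts) i a c
  rootPair-∷ {ts = ts} {a = a} x r = record
    { c≡i      = c≡i
    ; lower    = ≤-trans (tree-≤ x) lower
    ; upper    = upper
    ; nonright = subst (_< _) (sym (position-≥ {ts = ts} x lower)) (s<s nonright)
    ; jump     = λ a<b b<u → subst₂ _<_ (sym (position-≥ {ts = ts} x lower))
                   (sym (position-≥ {ts = ts} x (≤-trans lower (<⇒≤ a<b)))) (s<s (jump a<b b<u))
    }
    where open RootPair r

  rootPair : IntervalForest {suc k} l u ts → (a , c) ∈ rootPairs i (init ts) → RootPair l u ts i a c
  rootPair {ts = _ ∷ _ ∷ _} (x@leaf ∷ f) p = rootPair-∷ x (rootPair f p)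
  rootPair {ts = _ ∷ _ ∷ _} (x@(node _) ∷ f) (there p) = rootPair-∷ x (rootPair f p)
  rootPair {l = l} {ts = t₁ ∷ ts@(_ ∷ _)} {a = a} (x@(node _) ∷ f) (here refl) = record
    { c≡i      = refl
    ; lower    = l≤a
    ; upper    = forest-≤ f
    ; nonright = subst (_< _) (sym position≡0) z<s
    ; jump     = λ a<b b<u → subst₂ _<_ (sym position≡0)
                   (sym (position-≥ {ts = ts} x a<b)) z<s
    }
    where
    l≤a : l ≤ toℕ a
    l≤a = proj₁ (∈-tree⁻ x (here refl))
    position≡0 : position a (t₁ ∷ ts) ≡ 0
    position≡0 = position-< {ts = ts} x l≤a ≤-refl

  ascent  : IntervalTree l u t₁ → (a , c) ∈ ascents t₁ → Ascent (inv t₁) l u a c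
  -- Both labels of an ascent of a forest lie in the same tree.
  ascentᶠ : IntervalForest l u ts → (a , c) ∈ ascentsᶠ ts →
            Ascent (invᶠ ts) l u a c × position a ts ≡ position c ts
  ascent {a = a} (node {i = i} {ts = ts} f) p with ∈-++⁻ (rootPairs i (init ts)) p
  ... | inj₁ p with rootPair f p
  ...   | record { c≡i = refl ; lower = lower ; upper = upper ; nonright = nonright ; jump = jump }
      = record
    { lower    = lower
    ; a<c      = upper
    ; upper    = ≤-refl
    ; nonright = subst (_< _) (sym (inv-root {ts = ts} {a = a})) nonright
    ; jump     = λ {b} a<b b<c → subst₂ _<_ (sym (inv-root {ts = ts} {a = a}))
                   (sym (inv-root {ts = ts} {a = b})) (jump a<b b<c)
    ; level    = λ c<d d≤c → contradiction c<d (<⇒≱ d≤c)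
    }
  ascent {l = l} {t₁ = t₁} {a = a} {c = c} (node {i = i} {ts = ts} f) p | inj₂ q with ascentᶠ f q
  ...   | asc , eq = record
    { lower    = lower
    ; a<c      = a<c
    ; upper    = <-trans upper (n<1+n _)
    ; nonright = subst (_< _) (sym (inv-nonroot {ts = ts} {a = a} upper)) nonright
    ; jump     = λ {b} a<b b<c → subst₂ _<_ (sym (inv-nonroot {ts = ts} {a = a} upper))
                   (sym (inv-nonroot {ts = ts} {a = b} upper)) (jump a<b b<c)
    ; level    = level′
    }
    where
    open Ascent asc
    level′ : ∀ {d} → c Fin.< d → toℕ d < suc (toℕ i) → inv t₁ d c ≡ inv t₁ d a
    level′ c<d d≤i with last? d≤i
    ... | root rewrite inv-root {ts = ts} {a = a} | inv-root {ts = ts} {a = c} = sym eq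
    ... | below d<i rewrite inv-nonroot {ts = ts} {a = a} d<i | inv-nonroot {ts = ts} {a = c} d<i =
        level c<d d<i
  ascentᶠ {u = u} {ts = _ ∷ ts} {a = a} {c = c} (_∷_ {m = m} {t₁ = t₁} x f) p
    with ∈-++⁻ (ascents t₁) p
  ... | inj₁ p = record
    { lower    = lower
    ; a<c      = a<c
    ; upper    = <-≤-trans upper (forest-≤ f)
    ; nonright = subst (_< _) (sym (invᶠ-< {ts = ts} x lower a<c upper)) nonright
    ; jump     = λ a<b b<c → subst₂ _<_ (sym (invᶠ-< {ts = ts} x lower a<c upper))
                   (sym (invᶠ-< {ts = ts} x (≤-trans lower (<⇒≤ a<b)) b<c upper)) (jump a<b b<c)
    ; level    = level′
    } , trans (position-< {ts = ts} x lower (<-trans a<c upper))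
        (sym (position-< {ts = ts} x (≤-trans lower (<⇒≤ a<c)) upper))
    where
    open Ascent (ascent x p)
    level′ : ∀ {d} → c Fin.< d → toℕ d < u → invᶠ (t₁ ∷ ts) d c ≡ invᶠ (t₁ ∷ ts) d a
    level′ {d} c<d d<u with toℕ d <? m
    ... | yes d<m
        rewrite invᶠ-< {ts = ts} x lower (<-trans a<c c<d) d<m
              | invᶠ-< {ts = ts} x (≤-trans lower (<⇒≤ a<c)) c<d d<m = level c<d d<m
    ... | no  d≮m
        rewrite invᶠ-across {c = d} {ts = ts} x lower (<-trans a<c upper) (≮⇒≥ d≮m)
              | invᶠ-across {c = d} {ts = ts} x (≤-trans lower (<⇒≤ a<c)) upper (≮⇒≥ d≮m) = refl
  ... | inj₂ p = record
    { lower    = ≤-trans (tree-≤ x) lower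
    ; a<c      = a<c
    ; upper    = upper
    ; nonright = subst (_< _) (sym (invᶠ-≥ {ts = ts} x lower a<c)) nonright
    ; jump     = λ a<b b<c → subst₂ _<_ (sym (invᶠ-≥ {ts = ts} x lower a<c))
                   (sym (invᶠ-≥ {ts = ts} x (≤-trans lower (<⇒≤ a<b)) b<c)) (jump a<b b<c)
    ; level    = λ c<d d<u → trans (invᶠ-≥ {ts = ts} x m≤c c<d)
                   (trans (level c<d d<u) (sym (invᶠ-≥ {ts = ts} x lower (<-trans a<c c<d))))
    } , trans (position-≥ {ts = ts} x lower)
        (trans (cong suc (proj₂ (ascentᶠ f p))) (sym (position-≥ {ts = ts} x m≤c)))
    where
    open Ascent (proj₁ (ascentᶠ f p))
    m≤c : m ≤ toℕ c
    m≤c = ≤-trans lower (<⇒≤ a<c)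

  rootPairs-unique : IntervalForest {suc k} l u ts → Unique (rootPairs i (init ts))
  rootPairs-unique {ts = _ ∷ []}    _          = []
  rootPairs-unique {ts = _ ∷ _ ∷ _} (leaf ∷ f) = rootPairs-unique f
  rootPairs-unique {ts = _ ∷ _ ∷ _} (node _ ∷ f) =
    All.tabulate (λ { p refl → <⇒≱ ≤-refl (RootPair.lower (rootPair f p)) }) ∷ rootPairs-unique f

  ascents-unique  : IntervalTree l u t₁ → Unique (ascents t₁)
  ascentsᶠ-unique : IntervalForest l u ts → Unique (ascentsᶠ ts)
  ascents-unique leaf     = []
  ascents-unique (node f) = Unique.++⁺ (rootPairs-unique f) (ascentsᶠ-unique f) λ (p , q) →
    ℕ.<-irrefl (cong toℕ (RootPair.c≡i (rootPair f p))) (Ascent.upper (proj₁ (ascentᶠ f q)))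
  ascentsᶠ-unique []      = []
  ascentsᶠ-unique (x ∷ f) = Unique.++⁺ (ascents-unique x) (ascentsᶠ-unique f) λ (p , q) →
    let open Ascent in
    <⇒≱ (<-trans (a<c (ascent x p)) (upper (ascent x p))) (lower (proj₁ (ascentᶠ f q)))

  ----------------------------------------------------------------------
  -- Trees and their inversions determine each other

  -- If two forests on the same interval have the same positions, their first trees end at the same
  -- place; this is one of the two inequalities.
  split-≤ : u ≤ n → IntervalTree l m t₁ → IntervalTree l k t₂ → k ≤ u →
            (∀ {a} → l ≤ toℕ a → toℕ a < u → position a (t₁ ∷ ts) ≡ position a (t₂ ∷ ts′)) →
            k ≤ m
  split-≤ {u = u} {m = m} {t₁ = t₁} {k = k} {t₂ = t₂} {ts = ts} {ts′ = ts′} u≤n x y k≤u same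
    with m <? k
  ... | no  m≮k = ≮⇒≥ m≮k
  ... | yes m<k = contradiction
      (trans (sym (position-≥ {ts = ts} x m≤a))
        (trans (same l≤a a<u) (position-< {ts = ts′} y l≤a a<k))) λ ()
    where
    m<n = <-≤-trans m<k (≤-trans k≤u u≤n)
    m≤a = ≤-reflexive (sym (toℕ-fromℕ< m<n))
    l≤a = ≤-trans (tree-≤ x) m≤a
    a<k = subst (_< k) (sym (toℕ-fromℕ< m<n)) m<k
    a<u = <-≤-trans a<k k≤u

  -- An interval tree is determined by its inversions. The two upper bounds are kept apart because
  -- they are equal only propositionally when both are successors of labels.
  tree-injective : IntervalTree l u t₁ → IntervalTree l u′ t₂ → u ≡ u′ → u ≤ n →
    (∀ {a c} → l ≤ toℕ a → a Fin.< c → toℕ c < u → inv t₁ c a ≡ inv t₂ c a) → t₁ ≡ t₂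
  forest-injective : IntervalForest l u ts → IntervalForest l u ts′ → u ≤ n →
    (∀ {a} → l ≤ toℕ a → toℕ a < u → position a ts ≡ position a ts′) →
    (∀ {a c} → l ≤ toℕ a → a Fin.< c → toℕ c < u → invᶠ ts c a ≡ invᶠ ts′ c a) → ts ≡ ts′
  tree-injective leaf     leaf     _    _ _ = refl
  tree-injective leaf     (node g) refl _ _ = contradiction (forest-≤ g) (<⇒≱ ≤-refl)
  tree-injective (node f) leaf     refl _ _ = contradiction (forest-≤ f) (<⇒≱ ≤-refl)
  tree-injective (node {ts = ts} f) (node {ts = ts′} g) eq u≤n same
    with refl ← toℕ-injective (ℕ.suc-injective eq) =
    cong (node _) (forest-injective f g (<⇒≤ u≤n)
      (λ {a} l≤a a<i → trans (sym (inv-root {ts = ts} {a = a}))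
          (trans (same l≤a a<i ≤-refl) (inv-root {ts = ts′} {a = a})))
      (λ {a} l≤a a<c c<i → trans (sym (inv-nonroot {ts = ts} {a = a} c<i))
        (trans (same l≤a a<c (<-trans c<i (n<1+n _))) (inv-nonroot {ts = ts′} {a = a} c<i))))
  forest-injective [] [] _ _ _ = refl
  forest-injective (_∷_ {t₁ = t₁} {ts = ts} x f) (_∷_ {t₁ = t₂} {ts = ts′} y g) u≤n
    same-position same-inv
    with refl ← ℕ.≤-antisym
           (split-≤ {ts = ts′} {ts′ = ts} u≤n y x (forest-≤ f)
             λ l≤a a<u → sym (same-position l≤a a<u))
           (split-≤ {ts = ts} {ts′ = ts′} u≤n x y (forest-≤ g) same-position) =
    cong₂ _∷_
      (tree-injective x y refl (≤-trans (forest-≤ f) u≤n) λ l≤a a<c c<m →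
        trans (sym (invᶠ-< {ts = ts} x l≤a a<c c<m))
          (trans (same-inv l≤a a<c (<-≤-trans c<m (forest-≤ f))) (invᶠ-< {ts = ts′} y l≤a a<c c<m)))
      (forest-injective f g u≤n
        (λ m≤a a<u → ℕ.suc-injective (trans (sym (position-≥ {ts = ts} x m≤a))
          (trans (same-position (≤-trans (tree-≤ x) m≤a) a<u) (position-≥ {ts = ts′} y m≤a))))
        (λ m≤a a<c c<u → trans (sym (invᶠ-≥ {ts = ts} x m≤a a<c))
          (trans (same-inv (≤-trans (tree-≤ x) m≤a) a<c c<u) (invᶠ-≥ {ts = ts′} y m≤a a<c))))

  -- On the labels from l to u, the property P holds below cut and fails from cut on.
  record Threshold (P : Fin n → Set) (l u : ℕ) : Set where
    field
      cut   : ℕ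
      l≤cut : l ≤ cut
      cut≤u : cut ≤ u
      holds : ∀ {a} → l ≤ toℕ a → toℕ a < cut → P a
      fails : ∀ {a} → cut ≤ toℕ a → toℕ a < u → ¬ P a

  -- A decidable property that is closed downwards on an interval has a threshold.
  threshold : {P : Fin n → Set} → (∀ a → Dec (P a)) →
              (∀ {a b} → l ≤ toℕ a → a Fin.< b → toℕ b < u → P b → P a) →
              l ≤ u → u ≤ n → Threshold P l u
  threshold {l = l} {u = u} P? down l≤u u≤n with ℕ.m≤n⇒m<n∨m≡n l≤u
  ... | inj₂ refl = record
    { cut = l ; l≤cut = ≤-refl ; cut≤u = ≤-refl
    ; holds = λ l≤a a<l → contradiction l≤a (<⇒≱ a<l)
    ; fails = λ l≤a a<l → contradiction l≤a (<⇒≱ a<l)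
    }
  threshold {l = l} {u = suc u} {P = P} P? down _ u<n | inj₁ (s≤s l≤u) = case (P? x)
    where
    x : Fin n
    x = fromℕ< u<n
    x≡u : toℕ x ≡ u
    x≡u = toℕ-fromℕ< u<n
    last : ∀ {a} → toℕ a < suc u → Last x a
    last a≤u = last? (subst (λ v → _ < suc v) (sym x≡u) a≤u)
    case : Dec (P x) → Threshold P l (suc u)
    case (yes px) = record
      { cut = suc u ; l≤cut = ≤-trans l≤u (ℕ.n≤1+n u) ; cut≤u = ≤-refl
      ; holds = yes-case
      ; fails = λ u<a a≤u → contradiction u<a (<⇒≱ a≤u)
      }
      where
      yes-case : ∀ {a} → l ≤ toℕ a → toℕ a < suc u → P a
      yes-case l≤a a≤u with last a≤u
      ... | root      = px
      ... | below a<x = down l≤a a<x (s≤s (≤-reflexive x≡u)) px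
    case (no ¬px) = record
      { cut = cut ; l≤cut = l≤cut ; cut≤u = ≤-trans cut≤u (ℕ.n≤1+n u)
      ; holds = holds
      ; fails = no-case
      }
      where
      open Threshold (threshold P? (λ l≤a a<b b<u → down l≤a a<b (<-trans b<u (n<1+n u)))
              l≤u (<⇒≤ u<n))
      no-case : ∀ {a} → cut ≤ toℕ a → toℕ a < suc u → ¬ P a
      no-case m≤a a≤u with last a≤u
      ... | root      = ¬px
      ... | below a<x = fails m≤a (subst (_ <_) x≡u a<x)

  -- The multi-sets that agree with the inversions of some s-Tamari tree on all (c , a), a < c.
  record IsTamariInversions (J : MultiSet n) : Set where
    field
      bounded    : a Fin.< c → J c a ≤ s c
      monotone   : a Fin.< b → b Fin.< c → J c a ≤ J c b
      transitive : a Fin.< b → b Fin.< c → 0 < J b a → J c b ≤ J c a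

  module _ {J : MultiSet n} (isInversions : IsTamariInversions J) where
    open IsTamariInversions isInversions

    -- The multi-set I agrees with J on the labels from l to u.
    Realised : (l u : ℕ) → MultiSet n → Set
    Realised l u I = ∀ {a c} → l ≤ toℕ a → a Fin.< c → toℕ c < u → I c a ≡ J c a

    -- The root of the tree is the largest label i, and the label a goes to the child subtree of
    -- index J i a. The number d bounds u and makes the recursion structural.
    realise : ∀ d → l ≤ u → u ≤ d → u ≤ n → ∃[ t ] IntervalTree l u t × Realised l u (inv t)
    -- The forest in which the label a has position p a: by monotonicity of p the labels at position
    -- 0 form an initial interval, which gives the first tree, and pred (p a) is the position of a
    -- among the remaining trees. The last hypothesis forces J c a = 0 for a and c in different
    -- trees.
    realiseᶠ : ∀ k d (p : Fin n → ℕ) → l ≤ u → u ≤ d → u ≤ n →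
      (∀ {a} → l ≤ toℕ a → toℕ a < u → p a < k) →
      (∀ {a b} → l ≤ toℕ a → a Fin.< b → toℕ b < u → p a ≤ p b) →
      (∀ {a b} → l ≤ toℕ a → a Fin.< b → toℕ b < u → 0 < J b a → p b ≤ p a) →
      ∃[ ts ] IntervalForest {k} l u ts ×
        (∀ {a} → l ≤ toℕ a → toℕ a < u → position a ts ≡ p a) × Realised l u (invᶠ ts)
    realise {l = l} d l≤u u≤d u≤n with ℕ.m≤n⇒m<n∨m≡n l≤u
    ... | inj₂ refl = leaf , leaf , λ l≤a a<c c<l → contradiction (≤-trans l≤a (<⇒≤ a<c)) (<⇒≱ c<l)
    realise {l = l} {u = suc c} (suc d) _ (s≤s c≤d) c<n | inj₁ (s≤s l≤c)
      with i , refl ← label-at c<n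
      with realiseᶠ (suc (s i)) d (J i) l≤c c≤d (<⇒≤ c<n)
             (λ l≤a a<i → s≤s (bounded a<i)) (λ _ → monotone) (λ _ → transitive)
    ... | ts , f , same-position , same-inv = node i ts , node f , realised
      where
      realised : Realised l (suc (toℕ i)) (inv (node i ts))
      realised {a} {c} l≤a a<c c≤i with last? c≤i
      ... | root      = trans (inv-root {ts = ts} {a = a}) (same-position l≤a a<c)
      ... | below c<i = trans (inv-nonroot {ts = ts} {a = a} c<i) (same-inv l≤a a<c c<i)
    realiseᶠ {l = l} {u = u} zero d p l≤u u≤d u≤n bound _ _ with ℕ.m≤n⇒m<n∨m≡n l≤u
    ... | inj₂ refl = [] , [] , (λ l≤a a<l → contradiction l≤a (<⇒≱ a<l))
                    , λ l≤a a<c c<l → contradiction (≤-trans l≤a (<⇒≤ a<c)) (<⇒≱ c<l)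
    ... | inj₁ l<u = contradiction
        (bound {fromℕ< l<n} (≤-reflexive (sym l≡)) (subst (_< u) (sym l≡) l<u)) λ ()
      where
      l<n = <-≤-trans l<u u≤n
      l≡  = toℕ-fromℕ< l<n
    realiseᶠ {l = l} {u = u} (suc k) d p l≤u u≤d u≤n bound mono anti
      with threshold (λ a → p a ℕ.≟ 0)
             (λ l≤a a<b b<u pb≡0 → ℕ.n≤0⇒n≡0 (≤-trans (mono l≤a a<b b<u) (≤-reflexive pb≡0)))
             l≤u u≤n
    ... | record { cut = m ; l≤cut = l≤m ; cut≤u = m≤u ; holds = p≡0 ; fails = p≢0 }
      with realise d l≤m (≤-trans m≤u u≤d) (≤-trans m≤u u≤n)
         | realiseᶠ k d (λ a → pred (p a)) m≤u u≤d u≤n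
             (λ m≤a a<u → pred-< (p≢0 m≤a a<u) (bound (≤-trans l≤m m≤a) a<u))
             (λ m≤a a<b b<u → ℕ.pred-mono-≤ (mono (≤-trans l≤m m≤a) a<b b<u))
             (λ m≤a a<b b<u pos → ℕ.pred-mono-≤ (anti (≤-trans l≤m m≤a) a<b b<u pos))
      where
      pred-< : ∀ {x y} → x ≢ 0 → x < suc y → pred x < y
      pred-< {zero}  x≢0 _         = contradiction refl x≢0
      pred-< {suc x} _   (s≤s x<y) = x<y
    ... | t , x , realised | ts , f , same-position , realisedᶠ = t ∷ ts , x ∷ f , positions , invs
      where
      positions : ∀ {a} → l ≤ toℕ a → toℕ a < u → position a (t ∷ ts) ≡ p a
      positions {a} l≤a a<u with toℕ a <? m
      ... | yes a<m = trans (position-< {ts = ts} x l≤a a<m) (sym (p≡0 l≤a a<m))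
      ... | no  a≮m = trans (position-≥ {ts = ts} x m≤a)
                        (trans (cong suc (same-position m≤a a<u))
                            (ℕ.suc-pred (p a) ⦃ ≢-nonZero (p≢0 m≤a a<u) ⦄))
        where m≤a = ≮⇒≥ a≮m
      invs : Realised l u (invᶠ (t ∷ ts))
      invs {a} {c} l≤a a<c c<u with toℕ c <? m | toℕ a <? m
      ... | yes c<m | _       = trans (invᶠ-< {ts = ts} x l≤a a<c c<m) (realised l≤a a<c c<m)
      ... | no  c≮m | no  a≮m = trans (invᶠ-≥ {ts = ts} x (≮⇒≥ a≮m) a<c)
          (realisedᶠ (≮⇒≥ a≮m) a<c c<u)
      ... | no  c≮m | yes a<m = trans (invᶠ-across {c = c} {ts = ts} x l≤a a<m (≮⇒≥ c≮m)) (sym J≡0)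
        where
        J≡0 : J c a ≡ 0
        J≡0 = ℕ.n≤0⇒n≡0 (≮⇒≥ λ pos → p≢0 (≮⇒≥ c≮m) c<u
          (ℕ.n≤0⇒n≡0 (≤-trans (anti l≤a a<c c<u pos) (≤-reflexive (p≡0 l≤a a<m)))))

  ----------------------------------------------------------------------
  -- Tamari trees are interval trees

  -- xs lists each label from l to u exactly once.
  record Spans (l u : ℕ) (xs : List (Fin n)) : Set where
    field
      unique   : Unique xs
      sound    : a ∈ xs → l ≤ toℕ a × toℕ a < u
      complete : l ≤ toℕ a → toℕ a < u → a ∈ xs

  unique-labels  : IntervalTree l u t₁ → Unique (labels t₁)
  unique-labelsᶠ : IntervalForest l u ts → Unique (labelsᶠ ts)
  unique-labels leaf     = []
  unique-labels (node f) = All.tabulate (λ { p refl → ℕ.<-irrefl refl (proj₂ (∈-forest⁻ f p)) })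
    ∷ unique-labelsᶠ f
  unique-labelsᶠ []      = []
  unique-labelsᶠ (x ∷ f) = Unique.++⁺ (unique-labels x) (unique-labelsᶠ f) λ (p , q) →
    ∉-tree x (proj₁ (∈-forest⁻ f q)) p

  interval-decreasing  : IntervalTree l u t₁ → Decreasing t₁
  interval-decreasingᶠ : IntervalForest l u ts → u ≤ toℕ i →
                Vec.All (λ t → All (Fin._< i) (labels t) × Decreasing t) ts
  interval-decreasing leaf     = leaf
  interval-decreasing (node f) = node (interval-decreasingᶠ f ≤-refl)
  interval-decreasingᶠ [] _        = []
  interval-decreasingᶠ (x ∷ f) u≤i =
    (All.tabulate (λ p → <-≤-trans (proj₂ (∈-tree⁻ x p)) (≤-trans (forest-≤ f) u≤i))
    , interval-decreasing x)
    ∷ interval-decreasingᶠ f u≤i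

  toTamari : IntervalTree 0 n t₁ → TamariTree s
  toTamari {t₁ = t} x = record
    { tree          = t
    ; isSDecreasing = record
      { bijective  = ∼bag⇒↭ (unique∧set⇒bag (unique-labels x) (Unique.allFin⁺ n)
          (λ {a} → mk⇔ (λ _ → ∈-allFin a) (λ _ → ∈-tree⁺ x z≤n (toℕ<n a))))
      ; decreasing = interval-decreasing x
      }
    ; isTamari      = λ a<b b<c → inv-mono x z≤n a<b b<c (toℕ<n _)
    }

  -- The Tamari condition at the root says that positions increase weakly with the labels below it,
  -- so the labels of the first child subtree form an initial interval; then one proceeds with the
  -- others.
  toIntervalTree : l ≤ u → u ≤ n → Spans l u (labels t₁) → Decreasing t₁ →
    (∀ {a b c} → l ≤ toℕ a → a Fin.< b → b Fin.< c → toℕ c < u → inv t₁ c a ≤ inv t₁ c b) →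
    IntervalTree l u t₁
  toIntervalForest : l ≤ u → u ≤ n → Spans l u (labelsᶠ ts) → Vec.All Decreasing ts →
    (∀ {a b} → l ≤ toℕ a → a Fin.< b → toℕ b < u → position a ts ≤ position b ts) →
    (∀ {a b c} → l ≤ toℕ a → a Fin.< b → b Fin.< c → toℕ c < u → invᶠ ts c a ≤ invᶠ ts c b) →
    IntervalForest l u ts
  toIntervalTree {t₁ = leaf} l≤u u≤n spans _ _ with ℕ.m≤n⇒m<n∨m≡n l≤u
  ... | inj₂ refl = leaf
  ... | inj₁ l<u with label-at (<-≤-trans l<u u≤n)
  ...   | i , refl with () ← Spans.complete spans ≤-refl l<u
  toIntervalTree {l = l} {u = u} {t₁ = node i ts} l≤u u≤n spans (node decr) mono =
      case (ℕ.m≤n⇒m<n∨m≡n (proj₂ (sound (here refl))))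
    where
    open Spans spans
    labelsᶠ-< : ∀ {k} {ts : Vec (Tree s) k} →
        Vec.All (λ t → All (Fin._< i) (labels t) × Decreasing t) ts → All (Fin._< i) (labelsᶠ ts)
    labelsᶠ-< []              = []
    labelsᶠ-< ((p , _) ∷ ps) = All.++⁺ p (labelsᶠ-< ps)
    <i : ∀ {a} → a ∈ labelsᶠ ts → a Fin.< i
    <i = All.lookup (labelsᶠ-< decr)
    below-∈ : ∀ {a} → a Fin.< i → a ∈ i ∷ labelsᶠ ts → a ∈ labelsᶠ ts
    below-∈ i<i (here refl) = contradiction i<i (<⇒≱ ≤-refl)
    below-∈ _   (there p)   = p
    case : suc (toℕ i) < u ⊎ suc (toℕ i) ≡ u → IntervalTree l u (node i ts)
    case (inj₁ 1+i<u) with label-at (<-≤-trans 1+i<u u≤n)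
    ... | j , j≡1+i with complete {j}
        (≤-trans (proj₁ (sound (here refl))) (≤-trans (ℕ.n≤1+n _) (≤-reflexive (sym j≡1+i))))
        (subst (_< u) (sym j≡1+i) 1+i<u)
    ...   | here refl = contradiction (sym j≡1+i) ℕ.1+n≢n
    ...   | there j∈  = contradiction (<i j∈)
        (<⇒≱ (s≤s (≤-trans (ℕ.n≤1+n _) (≤-reflexive (sym j≡1+i)))))
    case (inj₂ refl) = node (toIntervalForest (proj₁ (sound (here refl))) (<⇒≤ u≤n)
      (record
        { unique   = AllPairs.tail unique
        ; sound    = λ p → proj₁ (sound (there p)) , <i p
        ; complete = λ l≤a a<i → below-∈ a<i (complete l≤a (<-trans a<i (n<1+n _)))
        })
      (Vec.map proj₂ decr)
      (λ {a} {b} l≤a a<b b<i → subst₂ _≤_ (inv-root {ts = ts} {a = a}) (inv-root {ts = ts} {a = b})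
          (mono l≤a a<b b<i ≤-refl))
      (λ {a} {b} l≤a a<b b<c c<i →
          subst₂ _≤_ (inv-nonroot {ts = ts} {a = a} c<i) (inv-nonroot {ts = ts} {a = b} c<i)
            (mono l≤a a<b b<c (<-trans c<i (n<1+n _)))))
  toIntervalForest {ts = []} l≤u u≤n spans _ _ _ with ℕ.m≤n⇒m<n∨m≡n l≤u
  ... | inj₂ refl = []
  ... | inj₁ l<u with label-at (<-≤-trans l<u u≤n)
  ...   | i , refl with () ← Spans.complete spans ≤-refl l<u
  toIntervalForest {l = l} {u = u} {ts = t₁ ∷ ts} l≤u u≤n spans (decr ∷ decrs) pos-mono mono
    with unique₁ , unique₂ , disjoint ← unique-++⁻ (labels t₁) (Spans.unique spans) =
    toIntervalTree l≤cut (≤-trans cut≤u u≤n)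
        (record { unique = unique₁ ; sound = sound₁ ; complete = holds }) decr
        (λ l≤a a<b b<c c<m → subst₂ _≤_
          (invᶠ-∈∈ (holds l≤a (<-trans a<b (<-trans b<c c<m)))
              (holds (≤-trans l≤a (<⇒≤ (<-trans a<b b<c))) c<m))
          (invᶠ-∈∈ (holds (≤-trans l≤a (<⇒≤ a<b)) (<-trans b<c c<m))
              (holds (≤-trans l≤a (<⇒≤ (<-trans a<b b<c))) c<m))
          (mono l≤a a<b b<c (<-≤-trans c<m cut≤u)))
    ∷ toIntervalForest cut≤u u≤n
        (record { unique = unique₂ ; sound = sound₂ disjoint ; complete = complete₂ }) decrs
        (λ m≤a a<b b<u → s≤s⁻¹ (subst₂ _≤_
          (position-∉ {ts = ts} (fails m≤a (<-trans a<b b<u)))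
          (position-∉ {ts = ts} (fails (≤-trans m≤a (<⇒≤ a<b)) b<u))
          (pos-mono (≤-trans l≤cut m≤a) a<b b<u)))
        (λ m≤a a<b b<c c<u → subst₂ _≤_
          (invᶠ-∉∉ (fails m≤a (<-trans a<b (<-trans b<c c<u)))
              (fails (≤-trans m≤a (<⇒≤ (<-trans a<b b<c))) c<u))
          (invᶠ-∉∉ (fails (≤-trans m≤a (<⇒≤ a<b)) (<-trans b<c c<u))
              (fails (≤-trans m≤a (<⇒≤ (<-trans a<b b<c))) c<u))
          (mono (≤-trans l≤cut m≤a) a<b b<c c<u))
    where
    open Spans spans using (sound; complete)
    down : ∀ {a b} → l ≤ toℕ a → a Fin.< b → toℕ b < u → b ∈ labels t₁ → a ∈ labels t₁
    down {a} {b} l≤a a<b b<u b∈ with _∈?_ _≟_ a (labels t₁)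
    ... | yes a∈ = a∈
    ... | no  a∉ = contradiction (pos-mono l≤a a<b b<u)
      (subst₂ (λ x y → ¬ x ≤ y) (sym (position-∉ {ts = ts} a∉)) (sym (position-∈ {ts = ts} b∈))
          λ ())
    open Threshold (threshold (λ a → _∈?_ _≟_ a (labels t₁)) down l≤u u≤n)
    sound₁ : ∀ {a} → a ∈ labels t₁ → l ≤ toℕ a × toℕ a < cut
    sound₁ {a} a∈ with toℕ a <? cut | sound (∈-++⁺ˡ a∈)
    ... | yes a<m | l≤a , _   = l≤a , a<m
    ... | no  a≮m | _   , a<u = contradiction a∈ (fails (≮⇒≥ a≮m) a<u)
    sound₂ : ∀ {a} → Disjoint (labels t₁) (labelsᶠ ts) → a ∈ labelsᶠ ts → cut ≤ toℕ a × toℕ a < u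
    sound₂ {a} disjoint a∈ with sound (∈-++⁺ʳ (labels t₁) a∈)
    ... | l≤a , a<u = ≮⇒≥ (λ a<m → disjoint (holds l≤a a<m , a∈)) , a<u
    complete₂ : ∀ {a} → cut ≤ toℕ a → toℕ a < u → a ∈ labelsᶠ ts
    complete₂ m≤a a<u with ∈-++⁻ (labels t₁) (complete (≤-trans l≤cut m≤a) a<u)
    ... | inj₁ a∈ = contradiction a∈ (fails m≤a a<u)
    ... | inj₂ a∈ = a∈

  intervalTree : (T : TamariTree s) → IntervalTree 0 n (TamariTree.tree T)
  intervalTree T = toIntervalTree z≤n ≤-refl
    (record
      { unique   = ↭ₛ.Unique-resp-↭ (setoid (Fin n)) (↭⇒↭ₛ (↭-sym bijective)) (Unique.allFin⁺ n)
      ; sound    = λ _ → z≤n , toℕ<n _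
      ; complete = λ _ _ → ∈-resp-↭ (↭-sym bijective) (∈-allFin _)
      })
    decreasing (λ _ a<b b<c _ → isTamari a<b b<c)
    where
    open TamariTree T
    open IsSDecreasing isSDecreasing

------------------------------------------------------------------------
-- Transitive closures

-- The maximum of finitely many numbers, 0 if there are none.
maximum : ∀ {n} (f : Fin n → ℕ) →
          ∃[ m ] (∀ i → f i ≤ m) × (m ≡ 0 ⊎ ∃[ i ] m ≡ f i)
maximum {zero}  f = 0 , (λ ()) , inj₁ refl
maximum {suc n} f with maximum (λ i → f (suc i))
... | m , bound , attained with ℕ.≤-total m (f zero)
...   | inj₁ m≤f₀ = f zero , (λ { zero → ≤-refl ; (suc i) → ≤-trans (bound i) m≤f₀ })
                           , inj₂ (zero , refl)
...   | inj₂ f₀≤m = m , (λ { zero → f₀≤m ; (suc i) → bound i }) , attained′ attained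
  where
  attained′ : m ≡ 0 ⊎ ∃[ i ] m ≡ f (suc i) → m ≡ 0 ⊎ ∃[ i ] m ≡ f i
  attained′ (inj₁ m≡0)       = inj₁ m≡0
  attained′ (inj₂ (i , m≡fᵢ)) = inj₂ (suc i , m≡fᵢ)

module _ {n : ℕ} {I : MultiSet n} where

  private variable
    a b c d e : Fin n

  path-≤ : Star (Step I) c a → toℕ a ≤ toℕ c
  path-≤ ε             = ≤-refl
  path-≤ ((b<c , _) ◅ p) = ≤-trans (path-≤ p) (<⇒≤ b<c)

  -- Reachability is decidable by recursion along the well-founded order, since steps descend.
  path? : Acc Fin._<_ c → ∀ a → Dec (Star (Step I) c a)
  stepPath? : Acc Fin._<_ c → ∀ a b → Dec (Step I c b × Star (Step I) b a)
  path? {c} rec a with c ≟ a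
  ... | yes refl = yes ε
  ... | no  c≢a  = map′ (λ (b , st , p) → st ◅ p)
                        (λ { ε → contradiction refl c≢a ; (st ◅ p) → _ , st , p })
                        (Fin.any? (stepPath? rec a))
  stepPath? {c} (acc rec) a b with b Fin.<? c
  ... | no  b≮c = no λ ((b<c , _) , _) → b≮c b<c
  ... | yes b<c = map′ (b<c ,_) proj₂ (0 <? I c b) ×-dec path? (rec b<c) a

  -- The multiplicity of (c , a) is the maximum over all b of weight c a b, which is I c b when a
  -- chain from c to a can start with the step to b, and 0 otherwise.
  closure : ∃[ J ] IsTransitiveClosure I J
  closure = (λ c a → proj₁ (maximum (weight c a))) , record
    { bound    = λ {c} {a} _ b st p →
        ≤-trans (weight-≥ c a b st p) (proj₁ (proj₂ (maximum (weight c a))) b)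
    ; attained = λ {c} {a} _ → attained c a
    }
    where
    steps? : ∀ c a b → Dec (Step I c b × Star (Step I) b a)
    steps? c = stepPath? (<-wellFounded c)
    weight : Fin n → Fin n → Fin n → ℕ
    weight c a b = if does (steps? c a b) then I c b else 0
    weight-≥ : ∀ c a b → Step I c b → Star (Step I) b a → I c b ≤ weight c a b
    weight-≥ c a b st p with steps? c a b
    ... | yes _ = ≤-refl
    ... | no ¬p = contradiction (st , p) ¬p
    attained : ∀ c a → proj₁ (maximum (weight c a)) ≡ 0 ⊎
      (∃[ b ] Step I c b × Star (Step I) b a × proj₁ (maximum (weight c a)) ≡ I c b)
    attained c a with maximum (weight c a)
    ... | m , _ , inj₁ m≡0 = inj₁ m≡0
    ... | m , _ , inj₂ (b , m≡w) with steps? c a b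
    ...   | yes (st , p) = inj₂ (b , st , p , m≡w)
    ...   | no _         = inj₁ m≡w

  closure-≤ : ∀ {J J′} → IsTransitiveClosure I J → IsTransitiveClosure I J′ →
              a Fin.< c → J c a ≤ J′ c a
  closure-≤ {a} {c} {J} {J′} tc tc′ a<c with IsTransitiveClosure.attained tc a<c
  ... | inj₁ J≡0                = subst (_≤ J′ c a) (sym J≡0) z≤n
  ... | inj₂ (b , st , p , J≡I) =
      subst (_≤ J′ c a) (sym J≡I) (IsTransitiveClosure.bound tc′ a<c b st p)

  closure-extensive : ∀ {J} → IsTransitiveClosure I J → a Fin.< c → I c a ≤ J c a
  closure-extensive {a} {c} tc a<c with 0 <? I c a
  ... | yes pos = IsTransitiveClosure.bound tc a<c a (a<c , pos) ε
  ... | no ¬pos = ≤-trans (≮⇒≥ ¬pos) z≤n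

  closure-cong : ∀ {J J′} → (∀ {a c} → a Fin.< c → J′ c a ≡ J c a) →
                 IsTransitiveClosure I J → IsTransitiveClosure I J′
  closure-cong {J} {J′} eq tc = record
    { bound    = λ a<c b st p → ≤-trans (bound a<c b st p) (≤-reflexive (sym (eq a<c)))
    ; attained = λ a<c → attained′ a<c (attained a<c)
    }
    where
    open IsTransitiveClosure tc
    attained′ : ∀ {a c} → a Fin.< c →
        J c a ≡ 0 ⊎ (∃[ b ] Step I c b × Star (Step I) b a × J c a ≡ I c b) →
                J′ c a ≡ 0 ⊎ (∃[ b ] Step I c b × Star (Step I) b a × J′ c a ≡ I c b)
    attained′ a<c (inj₁ J≡0)                = inj₁ (trans (eq a<c) J≡0)
    attained′ a<c (inj₂ (b , st , p , J≡I)) = inj₂ (b , st , p , trans (eq a<c) J≡I)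

  module _ {s : WeakComposition n}
    (bounded  : ∀ {a c} → a Fin.< c → I c a ≤ s c)
    (monotone : ∀ {a b c} → a Fin.< b → b Fin.< c → I c a ≤ I c b)
    where

    -- A chain from d to a can be cut short at any b with a < b ≤ d: replace the step that jumps
    -- over b by one to b, which is possible as monotonicity keeps the multiplicity positive.
    path-raise : a Fin.< b → toℕ b ≤ toℕ d → Star (Step I) d a → Star (Step I) d b
    path-raise a<b b≤a ε = contradiction b≤a (<⇒≱ a<b)
    path-raise {b = b} {d = d} a<b b≤d (_◅_ {j = e} st@(e<d , pos) p) with toℕ b ℕ.≤? toℕ e
    ... | yes b≤e = st ◅ path-raise a<b b≤e p
    ... | no  b≰e with ℕ.m≤n⇒m<n∨m≡n b≤d
    ...   | inj₁ b<d = (b<d , <-≤-trans pos (monotone (ℕ.≰⇒> b≰e) b<d)) ◅ ε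
    ...   | inj₂ b≡d with refl ← toℕ-injective b≡d = ε

    -- Transitivity holds for every closure. For monotonicity, take a chain from c to a whose first
    -- step is to d. If b ≤ d, path-raise gives a chain to b with the same first step; otherwise the
    -- step from c to b itself has at least the multiplicity of the step to d.
    closure-isTamariInversions : ∀ {J} → IsTransitiveClosure I J → IsTamariInversions {s = s} J
    closure-isTamariInversions {J} tc = record
      { bounded = bounded′ ; monotone = monotone′ ; transitive = transitive′ }
      where
      open IsTransitiveClosure tc
      bounded′ : a Fin.< c → J c a ≤ s c
      bounded′ {a} {c} a<c with attained a<c
      ... | inj₁ J≡0                       = subst (_≤ s c) (sym J≡0) z≤n
      ... | inj₂ (b , (b<c , _) , _ , J≡I) = subst (_≤ s c) (sym J≡I) (bounded b<c)
      monotone′ : a Fin.< b → b Fin.< c → J c a ≤ J c b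
      monotone′ {a} {b} {c} a<b b<c with attained (<-trans a<b b<c)
      ... | inj₁ J≡0 = subst (_≤ J c b) (sym J≡0) z≤n
      ... | inj₂ (d , st@(d<c , pos) , p , J≡I) = subst (_≤ J c b) (sym J≡I) I≤J
        where
        I≤J : I c d ≤ J c b
        I≤J with toℕ b ℕ.≤? toℕ d
        ... | yes b≤d = bound b<c d st (path-raise a<b b≤d p)
        ... | no  b≰d = ≤-trans (monotone (ℕ.≰⇒> b≰d) b<c) (closure-extensive tc b<c)
      transitive′ : a Fin.< b → b Fin.< c → 0 < J b a → J c b ≤ J c a
      transitive′ {a} {b} {c} a<b b<c pos with attained b<c | attained a<b
      ... | inj₁ J≡0                | _        = subst (_≤ J c a) (sym J≡0) z≤n
      ... | inj₂ _                  | inj₁ J≡0 =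
          contradiction pos (subst (λ x → ¬ 0 < x) (sym J≡0) λ ())
      ... | inj₂ (d , st , p , J≡I) | inj₂ (e , st′ , q , _) =
        subst (_≤ J c a) (sym J≡I) (bound (<-trans a<b b<c) d st (p ◅◅ st′ ◅ q))

------------------------------------------------------------------------
-- The tree T + A

module _ {n : ℕ} (A : List (Fin n × Fin n)) (I : MultiSet n) where

  private variable
    a b c : Fin n

  increase-∈ : (a , c) ∈ A → increase A I c a ≡ suc (I c a)
  increase-∈ {a} {c} p with _∈?_ (≡-dec _≟_ _≟_) (a , c) A
  ... | yes _ = refl
  ... | no ¬p = contradiction p ¬p

  increase-∉ : (a , c) ∉ A → increase A I c a ≡ I c a
  increase-∉ {a} {c} ¬p with _∈?_ (≡-dec _≟_ _≟_) (a , c) A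
  ... | yes p = contradiction p ¬p
  ... | no _  = refl

  increase-≥ : I c a ≤ increase A I c a
  increase-≥ {c} {a} with _∈?_ (≡-dec _≟_ _≟_) (a , c) A
  ... | yes _ = ℕ.n≤1+n _
  ... | no _  = ≤-refl

module _ {n : ℕ} {s : WeakComposition n} where
  open TamariTree using (tree; isTamari)

  private variable
    a b c d e : Fin n
    A B : List (Fin n × Fin n)

  tree-unique : (S T : TamariTree s) →
    (∀ {a c} → a Fin.< c → inv (tree S) c a ≡ inv (tree T) c a) → tree S ≡ tree T
  tree-unique S T same =
    tree-injective (intervalTree S) (intervalTree T) refl ≤-refl λ _ a<c _ → same a<c

  module _ (T : TamariTree s) (A⊆ascents : A ⊆ tamariAscents T) where
    private
      I I⁺ : MultiSet n
      I  = inv (tree T)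
      I⁺ = increase A I

      T-ascent : (a , c) ∈ tamariAscents T → Ascent {s = s} I 0 n a c
      T-ascent = ascent (intervalTree T)

      A-ascent : (a , c) ∈ A → Ascent {s = s} I 0 n a c
      A-ascent p = T-ascent (lookup A⊆ascents p)

      I⁺-bounded : a Fin.< c → I⁺ c a ≤ s c
      I⁺-bounded {a} {c} a<c with _∈?_ (≡-dec _≟_ _≟_) (a , c) A
      ... | yes p = Ascent.nonright (A-ascent p)
      ... | no _  = inv-bound (intervalTree T) z≤n a<c (toℕ<n _)

      I⁺-monotone : a Fin.< b → b Fin.< c → I⁺ c a ≤ I⁺ c b
      I⁺-monotone {a} {b} {c} a<b b<c = ≤-trans I⁺≤I (increase-≥ A I)
        where
        I⁺≤I : I⁺ c a ≤ I c b
        I⁺≤I with _∈?_ (≡-dec _≟_ _≟_) (a , c) A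
        ... | yes p = Ascent.jump (A-ascent p) a<b b<c
        ... | no _  = isTamari T a<b b<c

    -- The s-Tamari tree realising the transitive closure of I⁺ is T + A.
    plus : ∃[ S ] IsSum {s = s} T A S
    plus with closure {I = I⁺}
    ... | J , tc
      with realise (closure-isTamariInversions I⁺-bounded I⁺-monotone tc) n z≤n ≤-refl ≤-refl
    ...   | t , x , realised = toTamari x , closure-cong (λ a<c → realised z≤n a<c (toℕ<n _)) tc

    module _ (S : TamariTree s) (isSum : IsSum T A S) where

      plus-≽ : T ≼ S
      plus-≽ a<c = ≤-trans (increase-≥ A I) (closure-extensive isSum a<c)

      plus-∈ : (a , c) ∈ A → I c a < inv (tree S) c a
      plus-∈ {a} {c} p = ≤-trans (≤-reflexive (sym (increase-∈ A I p)))
        (closure-extensive isSum (Ascent.a<c (A-ascent p)))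

      private
        -- Multiplicities below a fixed c do not decrease along chains: a step of T is covered by
        -- transitivity, and a step created by A joins two labels at the same level.
        path-level : Star (Step I⁺) e a → e Fin.< c → I c e ≤ I c a
        path-level ε _ = ≤-refl
        path-level {e} {c = c} (_◅_ {j = d} (d<e , pos) p) e<c =
            ≤-trans step (path-level p (<-trans d<e e<c))
          where
          step : I c e ≤ I c d
          step with _∈?_ (≡-dec _≟_ _≟_) (d , e) A
          ... | yes q = ≤-reflexive (Ascent.level (A-ascent q) e<c (toℕ<n _))
          ... | no ¬q = inv-trans (intervalTree T) z≤n d<e e<c (toℕ<n _) pos

      -- A chain from c to a other than the step itself starts with some d strictly between a and c,
      -- where the multiplicity exceeds I c a; by path-level there is no such chain.
      plus-∉ : (a , c) ∈ tamariAscents T → (a , c) ∉ A → inv (tree S) c a ≤ I c a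
      plus-∉ {a} {c} p ¬q with IsTransitiveClosure.attained isSum a<c
        where open Ascent (T-ascent p)
      ... | inj₁ J≡0 = ≤-trans (≤-reflexive J≡0) z≤n
      ... | inj₂ (d , (d<c , _) , path , J≡I) with d ≟ a
      ...   | yes refl = ≤-reflexive (trans J≡I (increase-∉ A I ¬q))
      ...   | no  d≢a  = contradiction (path-level path d<c)
        (<⇒≱ (Ascent.jump (T-ascent p) (Fin.≤∧≢⇒< (path-≤ path) (λ a≡d → d≢a (sym a≡d))) d<c))

  plus-unique : (T S S′ : TamariTree s) → IsSum T A S → IsSum T A S′ → tree S ≡ tree S′
  plus-unique T S S′ isSum isSum′ = tree-unique S S′ λ a<c →
    ℕ.≤-antisym (closure-≤ isSum isSum′ a<c) (closure-≤ isSum′ isSum a<c)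

  plus-reflects-∈ : (T S : TamariTree s) → A ⊆ tamariAscents T → B ⊆ tamariAscents T →
    IsSum T A S → IsSum T B S → (a , c) ∈ A → (a , c) ∈ B
  plus-reflects-∈ {B = B} {a = a} {c = c} T S A⊆ B⊆ sumA sumB p with _∈?_ (≡-dec _≟_ _≟_) (a , c) B
  ... | yes q = q
  ... | no ¬q = contradiction (plus-∈ T A⊆ S sumA p) (ℕ.≤⇒≯ (plus-∉ T B⊆ S sumB (lookup A⊆ p) ¬q))

plus-injective : ∀ {n} {s : WeakComposition n} {A B} (T S : TamariTree s) →
  A ⊆ tamariAscents T → B ⊆ tamariAscents T → IsSum T A S → IsSum T B S → A ≡ B
plus-injective T S A⊆ B⊆ sumA sumB = sublist-unique (ascents-unique (intervalTree T)) A⊆ B⊆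
  (plus-reflects-∈ T S A⊆ B⊆ sumA sumB) (plus-reflects-∈ T S B⊆ A⊆ sumB sumA)

------------------------------------------------------------------------
-- Enumeration of Tamari trees

module _ {n : ℕ} {s : WeakComposition n} where

  private variable
    k l m u u′ d : ℕ
    t₁ : Tree s
    ts : Vec (Tree s) k

  vectors : ∀ k → List (Tree s) → List (Vec (Tree s) k)
  vectors zero    xs = [] ∷ []
  vectors (suc k) xs = cartesianProductWith _∷_ xs (vectors k xs)

  -- All trees with at most d internal nodes on each branch, with arbitrary labels.
  trees : ℕ → List (Tree s)
  trees zero    = leaf ∷ []
  trees (suc d) = leaf ∷ concatMap (λ i → map (node i) (vectors (suc (s i)) (trees d))) (allFin n)

  ∈-trees   : IntervalTree l u t₁ → u ≤ d → t₁ ∈ trees d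
  ∈-vectors : IntervalForest {k = k} l u ts → u ≤ d → ts ∈ vectors k (trees d)
  ∈-trees {d = zero}  leaf     _         = here refl
  ∈-trees {d = suc d} leaf     _         = here refl
  ∈-trees {d = suc d} (node {i = i} f) (s≤s i≤d) =
    there (∈-concatMap⁺ _ (lose (∈-allFin i) (∈-map⁺ (node i) (∈-vectors f i≤d))))
  ∈-vectors []      _   = here refl
  ∈-vectors (x ∷ f) u≤d = ∈-cartesianProductWith⁺ _∷_ (∈-trees x (≤-trans (forest-≤ f) u≤d))
      (∈-vectors f u≤d)

  tree-end   : IntervalTree l u t₁ → IntervalTree l u′ t₁ → u ≡ u′
  forest-end : IntervalForest l u ts → IntervalForest l u′ ts → u ≡ u′
  tree-end leaf leaf             = refl
  tree-end (node _) (node _)     = refl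
  forest-end [] []               = refl
  forest-end (x ∷ f) (y ∷ g) with refl ← tree-end x y = forest-end f g

  intervalTree?   : ∀ l t → Dec (∃[ u ] IntervalTree l u t)
  intervalForest? : ∀ l (ts : Vec (Tree s) k) → Dec (∃[ u ] IntervalForest l u ts)
  intervalTree? l leaf        = yes (l , leaf)
  intervalTree? l (node i ts) with intervalForest? l ts
  ... | no ¬f = no λ { (_ , node f) → ¬f (_ , f) }
  ... | yes (u , f) with u ℕ.≟ toℕ i
  ...   | yes refl = yes (_ , node f)
  ...   | no  u≢i  = no λ { (_ , node g) → u≢i (forest-end f g) }
  intervalForest? l []        = yes (l , [])
  intervalForest? l (t₁ ∷ ts) with intervalTree? l t₁
  ... | no ¬x = no λ { (_ , x ∷ _) → ¬x (_ , x) }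
  ... | yes (m , x) with intervalForest? m ts
  ...   | yes (u , f) = yes (u , x ∷ f)
  ...   | no ¬f = no λ { (u , y ∷ g) →
      ¬f (u , subst (λ m → IntervalForest m u ts) (tree-end y x) g) }

  infix 4 _≟ᵗ_ _≟ᶠ_
  _≟ᵗ_ : DecidableEquality (Tree s)
  _≟ᶠ_ : DecidableEquality (Vec (Tree s) k)
  leaf      ≟ᵗ leaf      = yes refl
  leaf      ≟ᵗ node _ _  = no λ ()
  node _ _  ≟ᵗ leaf      = no λ ()
  node i ts ≟ᵗ node j us with i ≟ j
  ... | no  i≢j  = no λ { refl → i≢j refl }
  ... | yes refl = map′ (cong (node i)) (λ { refl → refl }) (ts ≟ᶠ us)
  [] ≟ᶠ []             = yes refl
  (t ∷ ts) ≟ᶠ (u ∷ us) = map′ (λ { (refl , refl) → refl }) (λ { refl → refl , refl })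
      (t ≟ᵗ u ×-dec ts ≟ᶠ us)

  open TamariTree using (tree)

  -- The s-Tamari tree with underlying tree t, if there is one.
  toTamari? : Tree s → Maybe (TamariTree s)
  toTamari? t with intervalTree? 0 t
  ... | no _ = nothing
  ... | yes (u , x) with u ℕ.≟ n
  ...   | no _     = nothing
  ...   | yes refl = just (toTamari x)

  toTamari?-complete : (T : TamariTree s) → Maybe.Any (λ S → tree T ≡ tree S) (toTamari? (tree T))
  toTamari?-complete T with intervalTree? 0 (tree T)
  ... | no ¬x = contradiction (n , intervalTree T) ¬x
  ... | yes (u , x) with u ℕ.≟ n
  ...   | no  u≢n  = contradiction (tree-end x (intervalTree T)) u≢n
  ...   | yes refl = Maybe.just refl

  tamariTrees : Enumeration (TamariTrees s)
  tamariTrees = record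
    { elements   = deduplicate sameTree? candidates
    ; enumerates = λ T → ∈-deduplicate⁺ (TamariTrees s) sameTree? (λ y≈z x≈y → trans x≈y (sym y≈z))
        {z = T}
        (Any.mapMaybe⁺ toTamari? (trees n)
          (Any.map⁺ (lose (∈-trees (intervalTree T) ≤-refl) (toTamari?-complete T))))
    ; unique     = DecUnique.deduplicate-! decSetoid candidates
    }
    where
    sameTree? : Decidable (_≡_ on tree {s = s})
    sameTree? S T = tree S ≟ᵗ tree T
    decSetoid : DecSetoid 0ℓ 0ℓ
    decSetoid = record
      { isDecEquivalence = record
        { isEquivalence = Setoid.isEquivalence (TamariTrees s)
        ; _≟_           = sameTree?
        }
      }
    candidates : List (TamariTree s)
    candidates = mapMaybe toTamari? (trees n)

------------------------------------------------------------------------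
-- Subsets of a list

-- Subsets of a repetition-free list, as sublists.
Subset : {X : Set} → List X → Set
Subset xs = ∃[ A ] A ⊆ xs

subsets : {X : Set} (xs : List X) → List (Subset xs)
subsets []       = ([] , []) ∷ []
subsets (x ∷ xs) =
  map (λ (A , p) → A , x ∷ʳ p) (subsets xs) ++ map (λ (A , p) → x ∷ A , refl ∷ p) (subsets xs)

∈-subsets : {X : Set} {A xs : List X} → A ⊆ xs → Any (λ B → A ≡ proj₁ B) (subsets xs)
∈-subsets []         = here refl
∈-subsets (x ∷ʳ p)   = Any.++⁺ˡ (Any.map⁺ (∈-subsets p))
∈-subsets (refl ∷ p) = Any.++⁺ʳ _ (Any.map⁺ (Any.map (cong (_ ∷_)) (∈-subsets p)))

subsets-unique : {X : Set} {xs : List X} → Unique xs → AllPairs (_≢_ on proj₁) (subsets xs)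
subsets-unique []           = [] ∷ []
subsets-unique (x∉ ∷ xs!) = AllPairs.++⁺
  (AllPairs.map⁺ (subsets-unique xs!))
  (AllPairs.map⁺ (AllPairs.map (λ A≢B → λ { refl → A≢B refl }) (subsets-unique xs!)))
  (All.map⁺ (All.tabulate λ {(A , p)} _ →
      All.map⁺ (All.tabulate λ _ → λ { refl → All.lookup x∉ (lookup p (here refl)) refl })))

------------------------------------------------------------------------
-- Enumeration of faces

module _ {n : ℕ} {s : WeakComposition n} where
  open TamariTree using (tree)

  face : (T : TamariTree s) → Subset (tamariAscents T) → Face s
  face T (A , A⊆) = let S , isSum = plus T A⊆ in record
    { interval  = record { bottom = T ; top = S ; bottom≼top = plus-≽ T A⊆ S isSum }
    ; A         = A
    ; A⊆ascents = A⊆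
    ; top≡T+A   = isSum
    }

  -- Equal faces are presented by the same set of ascents; in particular the dimension of a face is
  -- well defined.
  face-A : (F G : Face s) → Setoid._≈_ (Asso s) F G → Face.A F ≡ Face.A G
  face-A F G (refl , refl) =
    plus-injective (bottom F) (top F) (A⊆ascents F) (A⊆ascents G) (top≡T+A F) (top≡T+A G)
    where open Face

  face-complete : (F : Face s) {T : TamariTree s} → tree (Face.bottom F) ≡ tree T →
    Any (λ B → Setoid._≈_ (Asso s) F (face T B)) (subsets (tamariAscents T))
  face-complete F {T} refl = Any.map
    (λ { {_ , B⊆} refl → refl ,
         plus-unique {A = A} T top (proj₁ (plus T B⊆)) top≡T+A (proj₂ (plus T B⊆)) })
    (∈-subsets A⊆ascents)
    where open Face F

  -- The faces over each T in turn, one for each subset of its ascents.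
  faces : Enumeration (TamariTrees s) → Enumeration (Asso s)
  faces 𝒯 = record
    { elements   = concatMap facesAt elements
    ; enumerates = λ F → Any.concatMap⁺ facesAt
        (Any.map (λ T≡ → Any.map⁺ (face-complete F T≡)) (enumerates (Face.bottom F)))
    ; unique     = AllPairs.concat⁺
        (All.map⁺ (All.tabulate λ {T} _ → AllPairs.map⁺
          (AllPairs.map (λ {B} {C} A≢A F≈G → A≢A (face-A (face T B) (face T C) F≈G))
            (subsets-unique (ascents-unique (intervalTree T))))))
        (AllPairs.map⁺ (AllPairs.map
          (λ T≢T′ → All.map⁺ (All.tabulate λ _ →
              All.map⁺ (All.tabulate λ _ F≈G → T≢T′ (proj₁ F≈G))))
          unique))
    }
    where
    open Enumeration 𝒯
    facesAt : TamariTree s → List (Face s)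
    facesAt T = map (face T) (subsets (tamariAscents T))

------------------------------------------------------------------------
-- Sums over enumerations

module _ (S : Setoid 0ℓ 0ℓ) where
  open Setoid S using (_≈_) renaming (Carrier to X; sym to ≈-sym; trans to ≈-trans)
  open Membershipₛ S using (_─_) renaming (_∈_ to _∈ₛ_)

  private variable
    x y : X
    xs ys : List X

  module _ (f : X → ℕ) (f-cong : ∀ {x y} → x ≈ y → f x ≡ f y) where

    sum-─ : (p : x ∈ₛ xs) → sum (map f xs) ≡ f x + sum (map f (xs ─ p))
    sum-─ {xs = _ ∷ xs} (here x≈y) = cong (_+ sum (map f xs)) (sym (f-cong x≈y))
    sum-─ {x} (there {x = y} {xs = ys} p) = begin
      f y + sum (map f ys)                ≡⟨ cong (f y +_) (sum-─ p) ⟩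
      f y + (f x + sum (map f (ys ─ p)))  ≡⟨ ℕ.+-assoc (f y) _ _ ⟨
      f y + f x + sum (map f (ys ─ p))    ≡⟨ cong (_+ sum (map f (ys ─ p))) (ℕ.+-comm (f y) (f x)) ⟩
      f x + f y + sum (map f (ys ─ p))    ≡⟨ ℕ.+-assoc (f x) _ _ ⟩
      f x + (f y + sum (map f (ys ─ p)))  ∎
      where open ≡-Reasoning

    ∈-─ : (p : x ∈ₛ xs) → y ∈ₛ xs → ¬ x ≈ y → y ∈ₛ (xs ─ p)
    ∈-─ (here x≈z) (here y≈z) x≉y = contradiction (≈-trans x≈z (≈-sym y≈z)) x≉y
    ∈-─ (here _)   (there q)  _   = q
    ∈-─ (there _)  (here y≈z) _   = here y≈z
    ∈-─ (there p)  (there q)  x≉y = there (∈-─ p q x≉y)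

    -- Remove the elements of xs from ys one after the other.
    sum-≤ : Uniqueₛ.Unique S xs → All (_∈ₛ ys) xs → sum (map f xs) ≤ sum (map f ys)
    sum-≤ []           []         = z≤n
    sum-≤ {xs = x ∷ xs} {ys = ys} (x≉ ∷ xs!) (x∈ ∷ xs∈) = begin
      f x + sum (map f xs)         ≤⟨ ℕ.+-monoʳ-≤ (f x)
          (sum-≤ xs! (All.zipWith (λ (x≉y , y∈) → ∈-─ x∈ y∈ x≉y) (x≉ , xs∈))) ⟩
      f x + sum (map f (ys ─ x∈))  ≡⟨ sum-─ x∈ ⟨
      sum (map f ys)               ∎
      where open ℕ.≤-Reasoning

    sum-unique : (E E′ : Enumeration S) →
      sum (map f (Enumeration.elements E)) ≡ sum (map f (Enumeration.elements E′))
    sum-unique E E′ = ℕ.≤-antisym (leq E E′) (leq E′ E)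
      where
      open Enumeration
      leq : ∀ E E′ → sum (map f (elements E)) ≤ sum (map f (elements E′))
      leq E E′ = sum-≤ (unique E) (All.tabulate λ {x} _ → enumerates E′ x)

sum-concatMap : {X Y : Set} (f : Y → ℕ) (g : X → List Y) (xs : List X) →
                sum (map f (concatMap g xs)) ≡ sum (map (λ x → sum (map f (g x))) xs)
sum-concatMap f g []       = refl
sum-concatMap f g (x ∷ xs) = begin
  sum (map f (g x ++ concatMap g xs))              ≡⟨ cong sum (map-++ f (g x) _) ⟩
  sum (map f (g x) ++ map f (concatMap g xs))      ≡⟨ sum-++ (map f (g x)) _ ⟩
  sum (map f (g x)) + sum (map f (concatMap g xs)) ≡⟨ cong (_ +_) (sum-concatMap f g xs) ⟩
  _ ∎
  where open ≡-Reasoning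

------------------------------------------------------------------------
-- Coefficients of polynomials

coeff-+ : ∀ p q k → coeff (p +ₚ q) k ≡ coeff p k + coeff q k
coeff-+ []      q       k       = refl
coeff-+ (x ∷ p) []      k       = sym (ℕ.+-identityʳ _)
coeff-+ (x ∷ p) (y ∷ q) zero    = refl
coeff-+ (x ∷ p) (y ∷ q) (suc k) = coeff-+ p q k

coeff-scale : ∀ c p k → coeff (map (c *_) p) k ≡ c * coeff p k
coeff-scale c []      k       = sym (ℕ.*-zeroʳ c)
coeff-scale c (x ∷ p) zero    = refl
coeff-scale c (x ∷ p) (suc k) = coeff-scale c p k

-- Multiplication by t.
shift : Poly → Poly
shift p = 0 ∷ p

-- Multiplication by c + t; the cases c = 0 and c = 1 are those needed.
coeff-linear : ∀ c p k → coeff ((c ∷ 1 ∷ []) *ₚ p) k ≡ c * coeff p k + coeff (shift p) k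
coeff-linear c p k = begin
  coeff (map (c *_) p +ₚ (0 ∷ (map (1 *_) p +ₚ (0 ∷ [])))) k
    ≡⟨ coeff-+ (map (c *_) p) _ k ⟩
  coeff (map (c *_) p) k + coeff (0 ∷ (map (1 *_) p +ₚ (0 ∷ []))) k
    ≡⟨ cong₂ _+_ (coeff-scale c p k) (tail≡ k) ⟩
  c * coeff p k + coeff (shift p) k ∎
  where
  open ≡-Reasoning
  coeff-0 : ∀ k → coeff (0 ∷ []) k ≡ 0
  coeff-0 zero    = refl
  coeff-0 (suc k) = refl
  tail≡ : ∀ k → coeff (0 ∷ (map (1 *_) p +ₚ (0 ∷ []))) k ≡ coeff (shift p) k
  tail≡ zero    = refl
  tail≡ (suc k) = begin
    coeff (map (1 *_) p +ₚ (0 ∷ [])) k           ≡⟨ coeff-+ (map (1 *_) p) _ k ⟩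
    coeff (map (1 *_) p) k + coeff (0 ∷ []) k    ≡⟨ cong₂ _+_ (coeff-scale 1 p k) (coeff-0 k) ⟩
    1 * coeff p k + 0                            ≡⟨ ℕ.+-identityʳ _ ⟩
    1 * coeff p k                                ≡⟨ ℕ.*-identityˡ _ ⟩
    coeff p k                                    ∎

coeff-∑ : ∀ {S} (E : Enumeration S) f k →
    coeff (∑ E f) k ≡ sum (map (λ x → coeff (f x) k) (Enumeration.elements E))
coeff-∑ {S} E f k = go (Enumeration.elements E)
  where
  go : ∀ xs → coeff (foldr (λ x p → f x +ₚ p) 0ₚ xs) k ≡ sum (map (λ x → coeff (f x) k) xs)
  go []       = refl
  go (x ∷ xs) = trans (coeff-+ (f x) _ k) (cong (coeff (f x) k +_) (go xs))

-- The binomial expansion of (1 + t)^|xs|: the subsets without x contribute the summand 1 of the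
-- factor 1 + t, those with x the summand t.
sum-subsets : {X : Set} (xs : List X) (k : ℕ) →
  sum (map (λ B → coeff (t ^ₚ length (proj₁ B)) k) (subsets xs)) ≡ coeff ((1ₚ +ₚ t) ^ₚ length xs) k
sum-subsets []       k = ℕ.+-identityʳ _
sum-subsets {X} (x ∷ xs) k = begin
  sum (map weight (map without (subsets xs) ++ map with-x (subsets xs)))
    ≡⟨ cong sum (map-++ weight (map without (subsets xs)) _) ⟩
  sum (map weight (map without (subsets xs)) ++ map weight (map with-x (subsets xs)))
    ≡⟨ sum-++ (map weight (map without (subsets xs))) _ ⟩
  sum (map weight (map without (subsets xs))) + sum (map weight (map with-x (subsets xs)))
    ≡⟨ cong₂ (λ ys zs → sum ys + sum zs) (map-∘ (subsets xs)) (map-∘ (subsets xs)) ⟨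
  sum (map (λ B → coeff (t ^ₚ length (proj₁ B)) k) (subsets xs))
    + sum (map (λ B → coeff (t *ₚ t ^ₚ length (proj₁ B)) k) (subsets xs))
    ≡⟨ cong₂ _+_ (sum-subsets xs k)
        (cong sum (map-cong (λ B → coeff-linear 0 (t ^ₚ length (proj₁ B)) k) (subsets xs))) ⟩
  coeff ((1ₚ +ₚ t) ^ₚ length xs) k
    + sum (map (λ B → coeff (shift (t ^ₚ length (proj₁ B))) k) (subsets xs))
    ≡⟨ cong₂ _+_ (sym (ℕ.*-identityˡ _)) (shifted k) ⟩
  1 * coeff ((1ₚ +ₚ t) ^ₚ length xs) k + coeff (shift ((1ₚ +ₚ t) ^ₚ length xs)) k
    ≡⟨ coeff-linear 1 ((1ₚ +ₚ t) ^ₚ length xs) k ⟨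
  coeff ((1ₚ +ₚ t) ^ₚ length (x ∷ xs)) k ∎
  where
  open ≡-Reasoning
  weight : Subset (x ∷ xs) → ℕ
  weight B = coeff (t ^ₚ length (proj₁ B)) k
  without with-x : Subset xs → Subset (x ∷ xs)
  without (A , p) = A , x ∷ʳ p
  with-x  (A , p) = x ∷ A , refl ∷ p
  sum-zero : ∀ {Y : Set} (ys : List Y) → sum (map (λ _ → 0) ys) ≡ 0
  sum-zero []       = refl
  sum-zero (_ ∷ ys) = sum-zero ys
  shifted : ∀ k → sum (map (λ B → coeff (shift (t ^ₚ length (proj₁ B))) k) (subsets xs)) ≡
            coeff (shift ((1ₚ +ₚ t) ^ₚ length xs)) k
  shifted zero    = sum-zero (subsets xs)
  shifted (suc k) = sum-subsets xs k

proposition2p4 : ∀ {n : ℕ} (s : WeakComposition n) →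
    Enumeration (TamariTrees s) × Enumeration (Asso s) ×
    (∀ (𝒯 : Enumeration (TamariTrees s)) (ℱ : Enumeration (Asso s)) →
    fPolynomial ℱ ≈ₚ (∑[ T ∈ 𝒯 ] (1ₚ +ₚ t) ^ₚ tasc T))
proposition2p4 s = tamariTrees , faces tamariTrees , λ 𝒯 ℱ k → begin
  coeff (fPolynomial ℱ) k
    ≡⟨ coeff-∑ ℱ _ k ⟩
  sum (map (weight k) (elements ℱ))
    ≡⟨ sum-unique (Asso s) (weight k)
         (λ {F} {G} F≈G → cong (λ A → coeff (t ^ₚ length A) k) (face-A F G F≈G)) ℱ (faces 𝒯) ⟩
  sum (map (weight k) (elements (faces 𝒯)))
    ≡⟨ sum-concatMap (weight k) _ (elements 𝒯) ⟩
  sum (map (λ T → sum (map (weight k) (map (face T) (subsets (tamariAscents T))))) (elements 𝒯))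
    ≡⟨ cong sum (map-cong
         (λ T → trans (cong sum (sym (map-∘ (subsets (tamariAscents T)))))
                      (sum-subsets (tamariAscents T) k))
         (elements 𝒯)) ⟩
  sum (map (λ T → coeff ((1ₚ +ₚ t) ^ₚ tasc T) k) (elements 𝒯))
    ≡⟨ coeff-∑ 𝒯 _ k ⟨
  coeff (∑[ T ∈ 𝒯 ] (1ₚ +ₚ t) ^ₚ tasc T) k ∎
  where
  open ≡-Reasoning
  open Enumeration using (elements)
  weight : ℕ → Face s → ℕ
  weight k F = coeff (t ^ₚ Face.dim F) k
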